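{- For any integers $k\ge 3$ and $n\ge \lfloor 111k/20\rfloor$, $$\nu_k(K_n)\ \ge\ \frac{8000\,(4107k^2-5416k+1309)}{37\,(111k-17)(111k-77)(37k-19)(3k-1)}\binom{n}{4},$$ and the coefficient of $\binom{n}{4}$ on the right-hand side satisfies $$\frac{8000\,(4107k^2-5416k+1309)}{37\,(111k-17)(111k-77)(37k-19)(3k-1)}=\frac{8000}{12321}\cdot\frac{1}{k^2}+\Theta\!\left(\frac{1}{k^3}\right)$$ (as $k\to\infty$).
   Context: A $k$-page book consists of $k$ halfplanes (pages) with a common boundary line (the spine). A $k$-page book drawing of a graph $G$ is a drawing of $G$ in a $k$-page book in which all vertices lie on the spine and edges do not cross the spine (each edge lies in one page). The $k$-page book crossing number $\nu_k(G)$ is the minimum number of edge-crossings over all $k$-page book drawings of $G$. Equivalently (convex model), $\nu_k(K_n)$ is the minimum, over all colorings of the edges of the complete geometric graph on the $n$ vertices of a convex polygon with $k$ colors, of the number of monochromatic crossings, i.e. pairs of edges of the same color that cross in their interiors. $K_n$ is the complete graph on $n$ vertices. -}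

module Defs where

open import Data.Nat using (ℕ; suc; _*_; _∸_; _^_; _≤_; _<_; NonZero; >-nonZero)
open import Data.Nat.Properties
  using (m*n≢0; m^n≢0; m<n⇒0<n∸m; m≤m*n; <-≤-trans; _<?_; ≤-reflexive; ≤-trans)
open import Data.Integer as ℤ using (+_)
open import Data.Rational as ℚ using (ℚ; 0ℚ; _/_)
open import Data.Empty.Irrelevant using (⊥-elim)
open import Data.Fin as Fin using (Fin; zero; combine; finToFun; funToFin)
open import Data.Fin.Properties as Fin using (finToFun-funToFin; remQuot-combine)
open import Data.List using (List; length; map; mapMaybe; filter; cartesianProduct; allFin)
open import Data.List.Properties using (filter-≐)
open import Data.List.Extrema.Nat using (argmin; f[argmin]≤f[xs])
open import Data.List.Membership.Propositional.Properties using (∈-allFin; ∈-map⁺)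
open import Data.List.Relation.Unary.All as All using ()
open import Data.Maybe using (Maybe; just; nothing)
open import Data.Product using (∃-syntax; _×_; _,_)
open import Relation.Nullary using (Dec; yes; no; _×-dec_)
open import Relation.Nullary.Decidable using (from-yes)
open import Relation.Unary using (Pred; Decidable)
open import Relation.Binary.PropositionalEquality using (_≡_; refl; sym; trans; cong; _≗_)

-- The vertices of the convex n-gon are the elements of Fin n in their cyclic
-- order around the polygon (equivalently, in their order along the spine).

record Edge (n : ℕ) : Set where
  constructor edge
  field
    lo hi  : Fin n
    .lo<hi : lo Fin.< hi

open Edge public

toEdge : ∀ {n} → Fin n × Fin n → Maybe (Edge n)
toEdge (i , j) with i Fin.<? j
... | yes i<j = just (edge i j i<j)
... | no  _   = nothing

edges : (n : ℕ) → List (Edge n)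
edges n = mapMaybe toEdge (cartesianProduct (allFin n) (allFin n))

-- Two chords of a convex polygon (two arcs drawn in the same page) cross in
-- their interiors exactly when their four endpoints are distinct and
-- alternate.  Crosses e f also asks that e be the chord containing the least
-- of the four endpoints, so of (e , f) and (f , e) at most one satisfies it.

Crosses : ∀ {n} → Edge n → Edge n → Set
Crosses e f = lo e Fin.< lo f × lo f Fin.< hi e × hi e Fin.< hi f

crosses? : ∀ {n} (e f : Edge n) → Dec (Crosses e f)
crosses? e f = (lo e Fin.<? lo f) ×-dec (lo f Fin.<? hi e) ×-dec (hi e Fin.<? hi f)

Colouring : ℕ → ℕ → Set
Colouring k n = Edge n → Fin k

MonochromaticCrossing : ∀ {k n} → Colouring k n → Pred (Edge n × Edge n) _
MonochromaticCrossing χ (e , f) = Crosses e f × χ e ≡ χ f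

monochromaticCrossing? : ∀ {k n} (χ : Colouring k n) → Decidable (MonochromaticCrossing χ)
monochromaticCrossing? χ (e , f) = crosses? e f ×-dec (χ e Fin.≟ χ f)

crossings : ∀ {k n} → Colouring k n → ℕ
crossings {n = n} χ =
  length (filter (monochromaticCrossing? χ) (cartesianProduct (edges n) (edges n)))

-- Every colouring is pointwise equal to some decode t.

decode : ∀ {k n} → Fin (k ^ (n * n)) → Colouring k n
decode t e = finToFun t (combine (lo e) (hi e))

allColourings : (k n : ℕ) → List (Colouring k n)
allColourings k n = map decode (allFin (k ^ (n * n)))

optimalColouring : (k n : ℕ) .{{_ : NonZero k}} → Colouring k n
optimalColouring k@(suc _) n = argmin crossings (λ _ → zero) (allColourings k n)

-- The k-page book crossing number of the complete graph on n vertices; that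
-- it is the minimum over all colourings is ν-attained and ν-minimal.

ν : (k n : ℕ) .{{_ : NonZero k}} → ℕ
ν k n = crossings (optimalColouring k n)

ν-attained : ∀ k n .{{_ : NonZero k}} → ∃[ χ ] crossings {k} {n} χ ≡ ν k n
ν-attained k n = optimalColouring k n , refl

crossings-cong : ∀ {k n} {χ ψ : Colouring k n} → χ ≗ ψ → crossings χ ≡ crossings ψ
crossings-cong {n = n} {χ} {ψ} χ≗ψ =
  cong length (filter-≐ (monochromaticCrossing? χ) (monochromaticCrossing? ψ)
    ( (λ {(e , f)} (x , eq) → x , trans (sym (χ≗ψ e)) (trans eq (χ≗ψ f)))
    , (λ {(e , f)} (x , eq) → x , trans (χ≗ψ e) (trans eq (sym (χ≗ψ f)))))
    (cartesianProduct (edges n) (edges n)))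

decode-surjective : ∀ {k n} .{{_ : NonZero k}} (χ : Colouring k n) → ∃[ t ] decode t ≗ χ
decode-surjective {k@(suc _)} {n} χ = funToFin g , λ e →
  trans (finToFun-funToFin g (combine (lo e) (hi e)))
        (trans (cong extend (remQuot-combine (lo e) (hi e))) (extend-edge e))
  where
  extend : Fin n × Fin n → Fin k
  extend (i , j) with i Fin.<? j
  ... | yes i<j = χ (edge i j i<j)
  ... | no  _   = zero
  g : Fin (n * n) → Fin k
  g x = extend (Fin.remQuot n x)
  extend-edge : ∀ e → extend (lo e , hi e) ≡ χ e
  extend-edge (edge i j i<j) with i Fin.<? j
  ... | yes _  = refl
  ... | no i≮j = ⊥-elim (i≮j i<j)

ν-minimal : ∀ k n .{{_ : NonZero k}} (χ : Colouring k n) → ν k n ≤ crossings χ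
ν-minimal k@(suc _) n χ with decode-surjective χ
... | t , t≗χ = ≤-trans
  (All.lookup (f[argmin]≤f[xs] {f = crossings} (λ _ → zero) (allColourings k n))
              (∈-map⁺ decode (∈-allFin t)))
  (≤-reflexive (crossings-cong t≗χ))

a*k∸b≢0 : ∀ a b k .{{_ : NonZero k}} → b < a → NonZero (a * k ∸ b)
a*k∸b≢0 a b k b<a = >-nonZero (m<n⇒0<n∸m (<-≤-trans b<a (m≤m*n a k)))

-- The truncated subtractions are exact: k ≥ 1.

denominator : ℕ → ℕ
denominator k = 37 * (111 * k ∸ 17) * (111 * k ∸ 77) * (37 * k ∸ 19) * (3 * k ∸ 1)

denominator≢0 : ∀ k .{{_ : NonZero k}} → NonZero (denominator k)
denominator≢0 k =
  m*n≢0 _ _ {{m*n≢0 _ _ {{m*n≢0 _ _ {{m*n≢0 37 _ {{_}} {{p}}}} {{q}}}} {{r}}}} {{s}}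
  where
  p = a*k∸b≢0 111 17 k (from-yes (17 <? 111))
  q = a*k∸b≢0 111 77 k (from-yes (77 <? 111))
  r = a*k∸b≢0 37 19 k (from-yes (19 <? 37))
  s = a*k∸b≢0 3 1 k (from-yes (1 <? 3))

coefficient : (k : ℕ) .{{_ : NonZero k}} → ℚ
coefficient k =
  ((+ 8000 ℤ.* (+ 4107 ℤ.* + (k ^ 2) ℤ.- + 5416 ℤ.* + k ℤ.+ + 1309)) / denominator k)
    {{denominator≢0 k}}

1/_^_ : (k e : ℕ) .{{_ : NonZero k}} → ℚ
1/ k ^ e = (+ 1 / (k ^ e)) {{m^n≢0 k e}}

fromℕ : ℕ → ℚ
fromℕ n = + n / 1

-- f ∈Θ g as k → ∞, in Knuth's sense: f is eventually squeezed between two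
-- positive multiples of g.  For g ≥ 0 this forces f to be eventually
-- nonnegative.  Rational constants are no restriction, since ℚ is dense in ℝ.

_∈Θ_ : (f g : (k : ℕ) .{{_ : NonZero k}} → ℚ) → Set
f ∈Θ g = ∃[ c ] ∃[ C ] ∃[ K ] (0ℚ ℚ.< c × 0ℚ ℚ.< C ×
  (∀ k .{{_ : NonZero k}} → K ≤ k → c ℚ.* g k ℚ.≤ f k × f k ℚ.≤ C ℚ.* g k))

{-# OPTIONS --safe #-}

-- Consider one page: e chords of a convex n-gon with c crossings. The key bound
-- is 8e ≤ 2c + 13(n − 2). Deleting a chord that is crossed at least four times
-- only helps, so suppose every chord is crossed at most three times. Cut off
-- triangles (i , a , j), where (i , j) is the current base and a is the farthest
-- neighbour of i, and induct on the two polygons that remain. The chords leaving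
-- a polygon through its base are recorded by their endpoints inside it; they
-- improve the bound for that polygon by the amount β, and the chords lost along
-- the cut are paid for by these improvements, which is a finite check.
--
-- Summing over the pages gives at least (5k − 2)(7k − 4) / 2 crossings for
-- n = 5k ≤ ⌊111k/20⌋, and averaging over deleted vertices shows that the
-- proportion of crossing quadruples does not decrease with n. The constant so
-- obtained, asymptotically 0.672 / k², exceeds 8000/12321 / k² ≈ 0.649 / k², and
-- what remains is a polynomial inequality in k.

module Submission where

open import Defs
open import Data.Nat
open import Data.Nat.Properties hiding (_≟_)
import Data.Nat.Properties as ℕ
open import Data.Nat.Combinatorics using (_C_; nC1≡n; nCk+nC[k+1]≡[n+1]C[k+1])
open import Data.Nat.DivMod using (/-monoˡ-≤; m*n/n≡m)
open import Data.Nat.ListAction using (sum)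
open import Data.Nat.ListAction.Properties using (sum-++)
open import Data.Nat.Tactic.RingSolver using (solve-∀)
open import Data.Bool using (true; false; if_then_else_)
open import Data.Fin as Fin using (Fin; zero; suc; toℕ; punchIn)
open import Data.Fin.Properties as Fin
  using (toℕ-injective; toℕ≤pred[n]; punchIn-mono-≤; punchIn-injective; punchInᵢ≢i)
open import Data.List
  using ( List; []; _∷_; _++_; map; mapMaybe; filter; length; take; drop; deduplicate
        ; cartesianProduct; allFin)
open import Data.List.Properties
  using ( map-++; map-cong; map-∘; map-tabulate; length-++; length-map; length-take
        ; length-tabulate; take++drop≡id; filter-notAll)
open import Data.List.Membership.Propositional using (_∈_; _∉_; find; lose)
open import Data.List.Membership.DecPropositional using () renaming (_∈?_ to member?)
open import Data.List.Membership.Propositional.Properties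
open import Data.List.Relation.Unary.Any as Any using (here; there; any?)
open import Data.List.Relation.Unary.All as All using ()
open import Data.List.Relation.Unary.AllPairs using ([]; _∷_)
open import Data.List.Relation.Unary.Unique.Propositional using (Unique)
import Data.List.Relation.Unary.Unique.Propositional.Properties as Unique
open import Data.List.Relation.Unary.Unique.DecPropositional.Properties ℕ._≟_ using (deduplicate-!)
open import Data.List.Relation.Binary.Pointwise using (Pointwise; []; _∷_; decidable)
open import Data.List.Relation.Binary.Subset.Propositional using (_⊆_)
open import Data.Maybe using (Maybe; just; nothing; maybe′)
open import Data.Product using (∃-syntax; _×_; _,_; proj₁; proj₂)
open import Data.Product.Properties using (≡-dec)
open import Data.Sum as Sum using (_⊎_; inj₁; inj₂; [_,_]′)
open import Data.Vec using (Vec; []; _∷_)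
import Data.Vec.Membership.Propositional as Vec
open import Data.Vec.Relation.Unary.Any using (here; there)
open import Data.Integer as ℤ using (ℤ)
import Data.Integer.Properties as ℤ
import Data.Integer.Tactic.RingSolver as ℤSolver
open import Data.Rational as ℚ using (ℚ; 0ℚ)
import Data.Rational.Properties as ℚ
open import Data.Rational.Unnormalised as ℚᵘ using (mkℚᵘ; *≤*)
import Data.Rational.Unnormalised.Properties as ℚᵘ
open import Function using (_∘_; const; flip; id)
open import Relation.Nullary
  using (Dec; yes; no; does; ¬_; contradiction; _×-dec_; _→-dec_; _⊎-dec_)
open import Relation.Nullary.Decidable using (True; toWitness; from-yes)
open import Relation.Unary using (Pred; Decidable)
open import Relation.Unary.Properties using (∁?)
open import Relation.Binary.PropositionalEquality
open import Algebra.Properties.CommutativeSemigroup +-commutativeSemigroup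
  using (interchange; x∙yz≈y∙xz)
open import Algebra.Properties.CommutativeSemigroup *-commutativeSemigroup
  using () renaming (x∙yz≈y∙xz to x*yz≈y*xz)
open import Level using (Level)

-- The obstacle is an asymmetry of the cut. Since `a` is the farthest neighbour of `i`, the left
-- base (i , a) is a side or a chord crossed at most three times, so at most three chords leave the
-- left polygon through it. Nothing forces (a , j) to be a chord, and more than three chords may
-- leave the right polygon. An absent base, however, leaves room for one more chord, which is worth
-- 8; hence the two induction hypotheses, `Weak` for every base and `Strong` for an absent one. Each
-- triangle brings 13 = 8 + 5: the 8 pays for the absent base in `Strong`, and 5 remains for the
-- chords that are cut. The number of leaving chords alone does not determine the improvement: three
-- of them are worth 14 from three different vertices, but only 5 from a single one. The base case
-- 5k of the averaging is close to optimal: at n = xk the page bounds give asymptotically the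
-- proportion 12(4x - 13)/(x³k²), which is largest at x = 39/8.

-- Sums over lists

private
  variable
    ℓ ℓ′ : Level
    A B : Set ℓ

∑ : List A → (A → ℕ) → ℕ
∑ xs f = sum (map f xs)

∑-mono : (xs : List A) {f g : A → ℕ} → (∀ {x} → x ∈ xs → f x ≤ g x) → ∑ xs f ≤ ∑ xs g
∑-mono []       f≤g = z≤n
∑-mono (x ∷ xs) f≤g = +-mono-≤ (f≤g (here refl)) (∑-mono xs (f≤g ∘ there))

∑-cong : (xs : List A) {f g : A → ℕ} → (∀ x → f x ≡ g x) → ∑ xs f ≡ ∑ xs g
∑-cong xs f≗g = cong sum (map-cong f≗g xs)

∑-++ : (xs ys : List A) (f : A → ℕ) → ∑ (xs ++ ys) f ≡ ∑ xs f + ∑ ys f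
∑-++ xs ys f = trans (cong sum (map-++ f xs ys)) (sum-++ (map f xs) (map f ys))

∑-map : (h : A → B) (xs : List A) (f : B → ℕ) → ∑ (map h xs) f ≡ ∑ xs (f ∘ h)
∑-map h xs f = cong sum (sym (map-∘ xs))

∑-const : (xs : List A) (c : ℕ) → ∑ xs (const c) ≡ length xs * c
∑-const []       c = refl
∑-const (x ∷ xs) c = cong (c +_) (∑-const xs c)

length≡∑ : (xs : List A) → length xs ≡ ∑ xs (const 1)
length≡∑ []       = refl
length≡∑ (x ∷ xs) = cong suc (length≡∑ xs)

∑-+ : (xs : List A) (f g : A → ℕ) → ∑ xs (λ x → f x + g x) ≡ ∑ xs f + ∑ xs g
∑-+ []       f g = refl
∑-+ (x ∷ xs) f g =
  trans (cong (f x + g x +_) (∑-+ xs f g)) (interchange (f x) (g x) _ _)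

∑-* : (xs : List A) (c : ℕ) (f : A → ℕ) → ∑ xs (λ x → c * f x) ≡ c * ∑ xs f
∑-* []       c f = sym (*-zeroʳ c)
∑-* (x ∷ xs) c f = trans (cong (c * f x +_) (∑-* xs c f)) (sym (*-distribˡ-+ c (f x) _))

∑-swap : (xs : List A) (ys : List B) (f : A → B → ℕ) →
         ∑ xs (λ x → ∑ ys (f x)) ≡ ∑ ys (λ y → ∑ xs (λ x → f x y))
∑-swap []       ys f = sym (trans (∑-const ys 0) (*-zeroʳ (length ys)))
∑-swap (x ∷ xs) ys f =
  trans (cong (∑ ys (f x) +_) (∑-swap xs ys f)) (sym (∑-+ ys (f x) _))

module _ {P : Pred A ℓ′} (P? : Decidable P) where

  ∑-split : (xs : List A) (f : A → ℕ) →
            ∑ xs f ≡ ∑ (filter P? xs) f + ∑ (filter (∁? P?) xs) f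
  ∑-split []       f = refl
  ∑-split (x ∷ xs) f with ih ← ∑-split xs f | does (P? x)
  ... | true  = trans (cong (f x +_) ih) (sym (+-assoc (f x) _ _))
  ... | false = trans (cong (f x +_) ih)
    (x∙yz≈y∙xz (f x) (∑ (filter P? xs) f) (∑ (filter (∁? P?) xs) f))

  length-split : (xs : List A) →
                 length xs ≡ length (filter P? xs) + length (filter (∁? P?) xs)
  length-split xs = begin
    length xs      ≡⟨ length≡∑ xs ⟩
    ∑ xs (const 1) ≡⟨ ∑-split xs (const 1) ⟩
    ∑ (filter P? xs) (const 1) + ∑ (filter (∁? P?) xs) (const 1)
      ≡⟨ cong₂ _+_ (length≡∑ (filter P? xs)) (length≡∑ (filter (∁? P?) xs)) ⟨
    length (filter P? xs) + length (filter (∁? P?) xs) ∎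
    where open ≡-Reasoning

  ∑-filter-≤ : (xs : List A) (f : A → ℕ) → ∑ (filter P? xs) f ≤ ∑ xs f
  ∑-filter-≤ xs f = ≤-trans (m≤m+n _ _) (≤-reflexive (sym (∑-split xs f)))

length≤∑ : (xs : List A) {f : A → ℕ} → (∀ {x} → x ∈ xs → 1 ≤ f x) → length xs ≤ ∑ xs f
length≤∑ xs 1≤f =
  ≤-trans (≤-reflexive (length≡∑ xs)) (∑-mono xs 1≤f)

term≤∑ : (xs : List A) {x : A} (f : A → ℕ) → x ∈ xs → f x ≤ ∑ xs f
term≤∑ (x ∷ xs) f (here refl)  = m≤m+n (f x) _
term≤∑ (y ∷ xs) f (there x∈xs) = ≤-trans (term≤∑ xs f x∈xs) (m≤n+m _ (f y))

𝟙 : {P : Set ℓ} → Dec P → ℕ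
𝟙 P? = if does P? then 1 else 0

𝟙-yes : {P : Set ℓ} (P? : Dec P) → P → 𝟙 P? ≡ 1
𝟙-yes (yes _) p = refl
𝟙-yes (no ¬p) p = contradiction p ¬p

𝟙-no : {P : Set ℓ} (P? : Dec P) → ¬ P → 𝟙 P? ≡ 0
𝟙-no (yes p) ¬p = contradiction p ¬p
𝟙-no (no _)  ¬p = refl

𝟙-mono : {P : Set ℓ} {Q : Set ℓ′} (P? : Dec P) (Q? : Dec Q) → (P → Q) → 𝟙 P? ≤ 𝟙 Q?
𝟙-mono (no _)  Q? f = z≤n
𝟙-mono (yes p) Q? f = ≤-reflexive (sym (𝟙-yes Q? (f p)))

unique-⊆⇒length-≤ : {xs ys : List A} → Unique xs → xs ⊆ ys → length xs ≤ length ys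
unique-⊆⇒length-≤ {xs = []}     _          _     = z≤n
unique-⊆⇒length-≤ {xs = x ∷ xs} (x∉ ∷ xs!) xs⊆ys
  with as , bs , refl ← ∈-∃++ (xs⊆ys (here refl)) = begin
  suc (length xs)              ≤⟨ s≤s (unique-⊆⇒length-≤ xs! xs⊆as++bs) ⟩
  suc (length (as ++ bs))      ≡⟨ cong suc (length-++ as) ⟩
  suc (length as + length bs)  ≡⟨ +-suc (length as) (length bs) ⟨
  length as + suc (length bs)  ≡⟨ length-++ as ⟨
  length (as ++ x ∷ bs)        ∎
  where
  open ≤-Reasoning
  xs⊆as++bs : xs ⊆ as ++ bs
  xs⊆as++bs y∈xs with ∈-++⁻ as (xs⊆ys (there y∈xs))
  ... | inj₁ y∈as         = ∈-++⁺ˡ y∈as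
  ... | inj₂ (here refl)  = contradiction refl (All.lookup x∉ y∈xs)
  ... | inj₂ (there y∈bs) = ∈-++⁺ʳ as y∈bs

-- The finite check behind the induction step

δ : List ℕ → ℕ
δ S = length (deduplicate ℕ._≟_ S)

δ≤ : {S T : List ℕ} → S ⊆ T → δ S ≤ length T
δ≤ {S} S⊆T = unique-⊆⇒length-≤ (deduplicate-! S) (S⊆T ∘ ∈-deduplicate⁻ ℕ._≟_ S)

δ-⊆ : {S T : List ℕ} → S ⊆ T → δ S ≤ δ T
δ-⊆ S⊆T = δ≤ (∈-deduplicate⁺ ℕ._≟_ ∘ S⊆T)

δ-++ : (S T : List ℕ) → δ (S ++ T) ≤ δ S + δ T
δ-++ S T = ≤-trans (δ≤ S++T⊆) (≤-reflexive (length-++ (deduplicate ℕ._≟_ S)))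
  where
  S++T⊆ : S ++ T ⊆ deduplicate ℕ._≟_ S ++ deduplicate ℕ._≟_ T
  S++T⊆ o∈ with ∈-++⁻ S o∈
  ... | inj₁ o∈S = ∈-++⁺ˡ (∈-deduplicate⁺ ℕ._≟_ o∈S)
  ... | inj₂ o∈T = ∈-++⁺ʳ (deduplicate ℕ._≟_ S) (∈-deduplicate⁺ ℕ._≟_ o∈T)

length-cartesianProduct : ∀ {A B : Set} (xs : List A) (ys : List B) →
  length (cartesianProduct xs ys) ≡ length xs * length ys
length-cartesianProduct []       ys = refl
length-cartesianProduct (x ∷ xs) ys = trans (length-++ (map (x ,_) ys))
  (cong₂ _+_ (length-map (x ,_) ys) (length-cartesianProduct xs ys))

-- A chord is determined by its two ends. This rules out impossible entries of the finite check, and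
-- it shows that chords with one end in common have distinct other ends.
unique⇒length≤δ*δ : {X : List (ℕ × ℕ)} → Unique X →
                    length X ≤ δ (map proj₁ X) * δ (map proj₂ X)
unique⇒length≤δ*δ {X} X! = begin
  length X                              ≤⟨ unique-⊆⇒length-≤ X! X⊆ ⟩
  length (cartesianProduct (dd (map proj₁ X)) (dd (map proj₂ X)))
                                        ≡⟨ length-cartesianProduct (dd (map proj₁ X)) _ ⟩
  δ (map proj₁ X) * δ (map proj₂ X)     ∎
  where
  open ≤-Reasoning
  dd = deduplicate ℕ._≟_
  X⊆ : X ⊆ cartesianProduct (dd (map proj₁ X)) (dd (map proj₂ X))
  X⊆ e∈X = ∈-cartesianProduct⁺ (∈-deduplicate⁺ ℕ._≟_ (∈-map⁺ proj₁ e∈X))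
                               (∈-deduplicate⁺ ℕ._≟_ (∈-map⁺ proj₂ e∈X))

-- The improvement due to b chords leaving a polygon from d distinct vertices.
-- The values were found by iterating the induction step to a fixed point.
β : ℕ → ℕ → ℕ
β 0                   d = 0
β 1                   d = 5
β 2                   d = 5 + 3 * (1 ⊓ (d ∸ 1))
β (suc (suc (suc _))) d = 5 + (5 * (1 ⊓ (d ∸ 1)) + 4 * (1 ⊓ (d ∸ 2)))

-- Includes the crossings of the b chords with the base.
γ : ℕ → ℕ → ℕ
γ b d = β b d + 2 * b

β-mono : ∀ b {d d′} → d ≤ d′ → β b d ≤ β b d′
β-mono 0                   d≤d′ = z≤n
β-mono 1                   d≤d′ = ≤-refl
β-mono 2                   d≤d′ = +-monoʳ-≤ 5 (*-monoʳ-≤ 3 (⊓-monoʳ-≤ 1 (∸-monoˡ-≤ 1 d≤d′)))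
β-mono (suc (suc (suc _))) d≤d′ = +-monoʳ-≤ 5 (+-mono-≤
  (*-monoʳ-≤ 5 (⊓-monoʳ-≤ 1 (∸-monoˡ-≤ 1 d≤d′)))
  (*-monoʳ-≤ 4 (⊓-monoʳ-≤ 1 (∸-monoˡ-≤ 2 d≤d′))))

-- The variables count chords cut by the triangle (i , a , j): x and v pass over a
-- and end before, respectively at, j; y, w and z leave the polygon from vertices
-- before, at and after a. dY, dZ, dO and dT are the numbers of distinct vertices
-- among the origins of y and of z and the two ends of x.
Cost : (x v y w z dY dZ dO dT : ℕ) → ℕ
Cost x v y w z dY dZ dO dT = 8 * (x + v) + β (y + w + z) (dY + 1 ⊓ w + dZ)

Gain : (x v y w z dY dO : ℕ) → ℕ
Gain x v y w z dY dO = γ (x + v + y) (dO ⊔ v ⊔ dY) + 2 * (w * (x + v) + v * z)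

-- The 5 is 13 - 8, what a triangle leaves after paying for the base in `Strong`. In the second
-- component the right polygon is treated by `Strong`, whose extra 8 turns 5 into 13; only three of
-- its leaving chords are then kept, and of their vertices only those of `Z` are relied upon.
Balanced : (x v y w z dY dZ dO dT : ℕ) → Set
Balanced x v y w z dY dZ dO dT =
  (z + x ≤ 3 → Cost x v y w z dY dZ dO dT ≤ 5 + Gain x v y w z dY dO + γ (z + x) (dZ ⊔ dT)) ×
  (Cost x v y w z dY dZ dO dT ≤ 13 + Gain x v y w z dY dO + β 3 dZ ⊎ z + x ≤ 3)

balanced? : ∀ x v y w z dY dZ dO dT → Dec (Balanced x v y w z dY dZ dO dT)
balanced? x v y w z dY dZ dO dT =
  ((_ ≤? _) →-dec (_ ≤? _)) ×-dec ((_ ≤? _) ⊎-dec (_ ≤? _))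

-- Two chords counted by x differ in one of their ends, hence x ≤ dO * dT.
table : ∀ {x} → x < 4 → ∀ {v} → v < 4 ∸ x → ∀ {y} → y < 4 ∸ x ∸ v →
        ∀ {w} → w < 4 ∸ y → ∀ {z} → z < 4 ∸ y ∸ w →
        ∀ {dY} → dY < suc y → ∀ {dZ} → dZ < suc z →
        ∀ {dO} → dO < suc x → ∀ {dT} → dT < suc x → x ≤ dO * dT →
        Balanced x v y w z dY dZ dO dT
table = from-yes
  (allUpTo? (λ x → allUpTo? (λ v → allUpTo? (λ y → allUpTo? (λ w → allUpTo? (λ z →
   allUpTo? (λ dY → allUpTo? (λ dZ → allUpTo? (λ dO → allUpTo? (λ dT →
     (x ≤? dO * dT) →-dec balanced? x v y w z dY dZ dO dT)
     (suc x)) (suc x)) (suc z)) (suc y)) (4 ∸ y ∸ w)) (4 ∸ y)) (4 ∸ x ∸ v)) (4 ∸ x)) 4)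

-- Crossings of a set of chords

Chord : Set
Chord = ℕ × ℕ

_≟ᶜ_ : (e f : Chord) → Dec (e ≡ f)
_≟ᶜ_ = ≡-dec ℕ._≟_ ℕ._≟_

crossing? : (p q s t : ℕ) → Dec (p < s × s < q × q < t)
crossing? p q s t = (p <? s) ×-dec (s <? q) ×-dec (q <? t)

-- A chord leaving a polygon from its vertex o crosses a chord (p , q) of the
-- polygon exactly when p < o < q, whatever its other end.
over? : (p q o : ℕ) → Dec (p < o × o < q)
over? p q o = (p <? o) ×-dec (o <? q)

cross : Chord → Chord → ℕ
cross (p , q) (s , t) = 𝟙 (crossing? p q s t)

over : Chord → ℕ → ℕ
over (p , q) o = 𝟙 (over? p q o)

cr : List Chord → List Chord → ℕ
cr A B = ∑ A λ e → ∑ B (cross e)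

st : List Chord → List ℕ → ℕ
st A S = ∑ A λ e → ∑ S (over e)

-- `cross` sees a crossing only from the chord with the smaller first end, so both orders are added.
load : Chord → List Chord → List ℕ → ℕ
load e I S = ∑ I (cross e) + ∑ I (λ f → cross f e) + ∑ S (over e)

cross≥1 : ∀ {p q s t} → p < s → s < q → q < t → 1 ≤ cross (p , q) (s , t)
cross≥1 p<s s<q q<t = ≤-reflexive (sym (𝟙-yes (crossing? _ _ _ _) (p<s , s<q , q<t)))

over≥1 : ∀ {p q o} → p < o → o < q → 1 ≤ over (p , q) o
over≥1 p<o o<q = ≤-reflexive (sym (𝟙-yes (over? _ _ _) (p<o , o<q)))

over≤crossʳ : ∀ {p q s t} → q < t → over (p , q) s ≤ cross (p , q) (s , t)
over≤crossʳ q<t =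
  𝟙-mono (over? _ _ _) (crossing? _ _ _ _) λ (p<s , s<q) → p<s , s<q , q<t

over≤crossˡ : ∀ {p q s t} → s < p → over (p , q) t ≤ cross (s , t) (p , q)
over≤crossˡ {p} {q} {s} {t} s<p =
  𝟙-mono (over? p q t) (crossing? s t p q) λ (p<t , t<q) → s<p , p<t , t<q

-- I is a set of chords of the polygon with vertices i, …, j, and S lists the
-- inner ends of the chords that leave it through the base (i , j).
record Window (i j : ℕ) (I : List Chord) (S : List ℕ) : Set where
  field
    unique : Unique I
    within : ∀ {e} → e ∈ I → i ≤ proj₁ e × 2 + proj₁ e ≤ proj₂ e × proj₂ e ≤ j
    inner  : ∀ {o} → o ∈ S → i < o × o < j
    few    : length S ≤ 3
    light  : ∀ {e} → e ∈ I → load e I S ≤ 3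

-- Here `m` is the number of vertices strictly between `i` and `j`. The additional 8 in `Strong` is
-- the room for the missing base. `Strong 0` is false, as the empty set of chords shows, so `Strong`
-- is proved for positive `m` only.
Strong Weak : ℕ → Set
Strong m = ∀ {i j I S} → j ≡ suc (m + i) → Window i j I S → (i , j) ∉ I →
  8 * length I + (8 + β (length S) (δ S)) ≤ 2 * (cr I I + st I S) + 13 * m
Weak m = ∀ {i j I S} → j ≡ suc (m + i) → Window i j I S →
  8 * length I + γ (length S) (δ S) ≤ 2 * (cr I I + st I S) + 13 * m

module Delete (b : Chord) (I : List Chord) where

  rest : List Chord
  rest = filter (∁? (_≟ᶜ b)) I

  rest⊆ : rest ⊆ I
  rest⊆ = proj₁ ∘ ∈-filter⁻ (∁? (_≟ᶜ b))

  b∉rest : b ∉ rest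
  b∉rest b∈ = proj₂ (∈-filter⁻ (∁? (_≟ᶜ b)) {xs = I} b∈) refl

  rest-unique : Unique I → Unique rest
  rest-unique = Unique.filter⁺ (∁? (_≟ᶜ b))

  length-rest : Unique I → length I ≤ suc (length rest)
  length-rest I! = begin
    length I                                      ≡⟨ length-split (_≟ᶜ b) I ⟩
    length (filter (_≟ᶜ b) I) + length rest        ≤⟨ +-monoˡ-≤ _ (unique-⊆⇒length-≤ {ys = b ∷ []}
      (Unique.filter⁺ (_≟ᶜ b) I!) (here ∘ proj₂ ∘ ∈-filter⁻ (_≟ᶜ b) {xs = I})) ⟩
    suc (length rest)                             ∎
    where open ≤-Reasoning

  ∑-rest : b ∈ I → (f : Chord → ℕ) → f b + ∑ rest f ≤ ∑ I f
  ∑-rest b∈I f = begin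
    f b + ∑ rest f                      ≤⟨ +-monoˡ-≤ _ (term≤∑ _ f (∈-filter⁺ (_≟ᶜ b) b∈I refl)) ⟩
    ∑ (filter (_≟ᶜ b) I) f + ∑ rest f    ≡⟨ ∑-split (_≟ᶜ b) I f ⟨
    ∑ I f                               ∎
    where open ≤-Reasoning

  ∑-rest-≤ : (f : Chord → ℕ) → ∑ rest f ≤ ∑ I f
  ∑-rest-≤ = ∑-filter-≤ (∁? (_≟ᶜ b)) I

  cr-rest-≤ : cr rest rest ≤ cr I I
  cr-rest-≤ = ≤-trans (∑-mono rest (λ {e} _ → ∑-rest-≤ (cross e))) (∑-rest-≤ _)

  window : ∀ {i j S} → Window i j I S → Window i j rest S
  window W = record
    { unique = rest-unique (Window.unique W)
    ; within = Window.within W ∘ rest⊆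
    ; inner  = Window.inner W
    ; few    = Window.few W
    ; light  = λ {e} e∈ → ≤-trans
        (+-monoˡ-≤ _ (+-mono-≤ (∑-rest-≤ (cross e)) (∑-rest-≤ (λ f → cross f e))))
        (Window.light W (rest⊆ e∈))
    }

-- If the base is absent, the spare 8 covers the term 2 · |S| ≤ 6 of `γ`. If it is present, removing
-- it costs 8, but every leaving chord crosses it, and these crossings pay for that term. For `m` =
-- 0 there is no room for chords or for inner ends.
weaken : ∀ {m} → (∀ {m′} → m ≡ suc m′ → Strong m) → Weak m
weaken {zero} _ {i} {I = []} {S = []} refl W = z≤n
weaken {zero} _ {i} {I = e ∷ I} refl W =
  let i≤l , l<h , h≤j = Window.within W (here refl) in
  contradiction (≤-trans (s≤s (s≤s i≤l)) (≤-trans l<h h≤j)) (<-irrefl refl)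
weaken {zero} _ {i} {S = o ∷ S} refl W =
  let i<o , o<j = Window.inner W (here refl) in contradiction (<-≤-trans i<o (s≤s⁻¹ o<j)) (<-irrefl refl)
weaken {m@(suc _)} strong {i} {j} {I} {S} j≡ W with member? _≟ᶜ_ (i , j) I
... | no b∉I = ≤-trans (+-monoʳ-≤ (8 * length I) γ≤8+β) (strong refl j≡ W b∉I)
  where
  γ≤8+β : γ (length S) (δ S) ≤ 8 + β (length S) (δ S)
  γ≤8+β = ≤-trans (+-monoʳ-≤ (β (length S) (δ S)) (≤-trans (*-monoʳ-≤ 2 (Window.few W)) (m≤m+n 6 2)))
                  (≤-reflexive (+-comm (β (length S) (δ S)) 8))
... | yes b∈I = begin
  8 * length I + γ (length S) (δ S)
    ≤⟨ +-monoˡ-≤ _ (*-monoʳ-≤ 8 (length-rest (Window.unique W))) ⟩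
  8 * suc (length rest) + (β (length S) (δ S) + 2 * length S)
    ≡⟨ shuffle₁ (length rest) (β (length S) (δ S)) (length S) ⟩
  (8 * length rest + (8 + β (length S) (δ S))) + 2 * length S
    ≤⟨ +-monoˡ-≤ _ (strong refl j≡ (window W) b∉rest) ⟩
  (2 * (cr rest rest + st rest S) + 13 * m) + 2 * length S
    ≡⟨ shuffle₂ (cr rest rest) (st rest S) m (length S) ⟩
  2 * (cr rest rest + (length S + st rest S)) + 13 * m
    ≤⟨ +-monoˡ-≤ _ (*-monoʳ-≤ 2 (+-mono-≤ cr-rest-≤ (≤-trans
         (+-monoˡ-≤ _ (length≤∑ S λ o∈S → let i<o , o<j = Window.inner W o∈S in over≥1 i<o o<j))
         (∑-rest b∈I (λ e → ∑ S (over e)))))) ⟩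
  2 * (cr I I + st I S) + 13 * m ∎
  where
  open ≤-Reasoning
  open Delete (i , j) I
  shuffle₁ : ∀ n b s → 8 * suc n + (b + 2 * s) ≡ (8 * n + (8 + b)) + 2 * s
  shuffle₁ = solve-∀
  shuffle₂ : ∀ c t m s → (2 * (c + t) + 13 * m) + 2 * s ≡ 2 * (c + (s + t)) + 13 * m
  shuffle₂ = solve-∀

-- Cutting a polygon along the triangle (i , a , j)

farthest : ∀ i (I : List Chord) → ∃[ a ] i < a × (a ≡ suc i ⊎ (i , a) ∈ I) ×
           (∀ {e} → e ∈ I → proj₁ e ≡ i → proj₂ e ≤ a)
-- The default is the side from `i` to the next vertex; it survives when no chord starts at `i`.
farthest i [] = suc i , ≤-refl , inj₁ refl , λ ()
farthest i ((l , h) ∷ I) with a , i<a , attained , bound ← farthest i I | l ℕ.≟ i | h ≤? a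
... | no l≢i   | _ = a , i<a , Sum.map₂ there attained ,
  λ { (here refl) l≡i → contradiction l≡i l≢i ; (there e∈) → bound e∈ }
... | yes _    | yes h≤a = a , i<a , Sum.map₂ there attained ,
  λ { (here refl) _ → h≤a ; (there e∈) → bound e∈ }
... | yes refl | no h≰a = h , <-trans i<a (≰⇒> h≰a) , inj₂ (here refl) ,
  λ { (here refl) _ → ≤-refl ; (there e∈) l≡i → ≤-trans (bound e∈ l≡i) (<⇒≤ (≰⇒> h≰a)) }

module Split {i a j : ℕ} {I : List Chord} {S : List ℕ} (W : Window i j I S) (b∉I : (i , j) ∉ I)
  (i<a : i < a) (a<j : a < j) (attained : a ≡ suc i ⊎ (i , a) ∈ I)
  (bound : ∀ {e} → e ∈ I → proj₁ e ≡ i → proj₂ e ≤ a) where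

  open Window W

  private
    left? : Decidable (λ (e : Chord) → proj₂ e ≤ a)
    left? e = proj₂ e ≤? a
    right? : Decidable (λ (e : Chord) → a ≤ proj₁ e)
    right? e = a ≤? proj₁ e
    toJ? : Decidable (λ (e : Chord) → j ≤ proj₂ e)
    toJ? e = j ≤? proj₂ e
    rest : List Chord
    rest = filter (∁? left?) I
    restS : List ℕ
    restS = filter (∁? (_<? a)) S

  -- R consists of the chords passing over a, V of those among them ending at j;
  -- Y, W₀ and Z are the parts of S before, at and after a.
  I₁ I₂ R V X : List Chord
  I₁ = filter left? I
  I₂ = filter right? rest
  R  = filter (∁? right?) rest
  V  = filter toJ? R
  X  = filter (∁? toJ?) R

  Y W₀ Z S₁ S₂ : List ℕ
  Y  = filter (_<? a) S
  Z  = filter (a <?_) restS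
  W₀ = filter (∁? (a <?_)) restS
  S₁ = map proj₁ R ++ Y
  S₂ = Z ++ map proj₂ X

  I₁⊆ : ∀ {e} → e ∈ I₁ → e ∈ I × proj₂ e ≤ a
  I₁⊆ = ∈-filter⁻ left?

  I₂⊆ : ∀ {e} → e ∈ I₂ → e ∈ I × a ≤ proj₁ e
  I₂⊆ e∈ = let e∈rest , a≤l = ∈-filter⁻ right? {xs = rest} e∈ in
           proj₁ (∈-filter⁻ (∁? left?) e∈rest) , a≤l

  -- By the choice of `a`, a chord starting at `i` does not pass over `a`. Hence a chord of `R`
  -- starts at an inner vertex of the left polygon and leaves it through (i , a).
  R⊆ : ∀ {e} → e ∈ R → e ∈ I × (i < proj₁ e × proj₁ e < a) × (a < proj₂ e × proj₂ e ≤ j)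
  R⊆ {e} e∈ =
    let e∈rest , a≰l = ∈-filter⁻ (∁? right?) {xs = rest} e∈
        e∈I , h≰a    = ∈-filter⁻ (∁? left?) e∈rest
        i≤l , _ , h≤j = within e∈I
    in e∈I , (≤∧≢⇒< i≤l (λ i≡l → h≰a (bound e∈I (sym i≡l))) , ≰⇒> a≰l) , (≰⇒> h≰a , h≤j)

  X⊆ : ∀ {e} → e ∈ X → e ∈ R × proj₂ e < j
  X⊆ e∈ = let e∈R , j≰h = ∈-filter⁻ (∁? toJ?) {xs = R} e∈ in e∈R , ≰⇒> j≰h

  V⊆ : ∀ {e} → e ∈ V → e ∈ R × proj₂ e ≡ j
  V⊆ e∈ = let e∈R , j≤h = ∈-filter⁻ toJ? {xs = R} e∈ in
          e∈R , ≤-antisym (proj₂ (proj₂ (proj₂ (R⊆ e∈R)))) j≤h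

  Y⊆ : ∀ {o} → o ∈ Y → o ∈ S × o < a
  Y⊆ = ∈-filter⁻ (_<? a)

  Z⊆ : ∀ {o} → o ∈ Z → o ∈ S × a < o
  Z⊆ o∈ = let o∈rest , a<o = ∈-filter⁻ (a <?_) {xs = restS} o∈ in
          proj₁ (∈-filter⁻ (∁? (_<? a)) o∈rest) , a<o

  W₀⊆ : ∀ {o} → o ∈ W₀ → o ≡ a
  W₀⊆ o∈ = let o∈rest , a≮o = ∈-filter⁻ (∁? (a <?_)) {xs = restS} o∈
               _ , o≮a      = ∈-filter⁻ (∁? (_<? a)) {xs = S} o∈rest
           in ≤-antisym (≮⇒≥ a≮o) (≮⇒≥ o≮a)

  ∑I : (f : Chord → ℕ) → ∑ I f ≡ ∑ I₁ f + (∑ I₂ f + ∑ R f)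
  ∑I f = trans (∑-split left? I f) (cong (∑ I₁ f +_) (∑-split right? rest f))

  ∑S : (g : ℕ → ℕ) → ∑ S g ≡ ∑ Y g + (∑ Z g + ∑ W₀ g)
  ∑S g = trans (∑-split (_<? a) S g) (cong (∑ Y g +_) (∑-split (a <?_) restS g))

  length-I : length I ≡ length I₁ + (length I₂ + length R)
  length-I = trans (length-split left? I) (cong (length I₁ +_) (length-split right? rest))

  length-S : length S ≡ length Y + (length Z + length W₀)
  length-S = trans (length-split (_<? a) S) (cong (length Y +_) (length-split (a <?_) restS))

  length-R : length R ≡ length V + length X
  length-R = length-split toJ? R

  length-S₁ : length S₁ ≡ length R + length Y
  length-S₁ = trans (length-++ (map proj₁ R)) (cong (_+ length Y) (length-map proj₁ R))

  length-S₂ : length S₂ ≡ length Z + length X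
  length-S₂ = trans (length-++ Z) (cong (length Z +_) (length-map proj₂ X))

  ∑I₁≤ : (f : Chord → ℕ) → ∑ I₁ f ≤ ∑ I f
  ∑I₁≤ = ∑-filter-≤ left? I

  ∑I₂≤ : (f : Chord → ℕ) → ∑ I₂ f ≤ ∑ I f
  ∑I₂≤ f = ≤-trans (m≤m+n _ _) (≤-trans (m≤n+m _ (∑ I₁ f)) (≤-reflexive (sym (∑I f))))

  ∑I₁R≤ : (f : Chord → ℕ) → ∑ I₁ f + ∑ R f ≤ ∑ I f
  ∑I₁R≤ f = ≤-trans (+-monoʳ-≤ (∑ I₁ f) (m≤n+m _ _)) (≤-reflexive (sym (∑I f)))

  ∑I₂R≤ : (f : Chord → ℕ) → ∑ I₂ f + ∑ R f ≤ ∑ I f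
  ∑I₂R≤ f = ≤-trans (m≤n+m _ (∑ I₁ f)) (≤-reflexive (sym (∑I f)))

  ∑R≤ : (f : Chord → ℕ) → ∑ R f ≤ ∑ I f
  ∑R≤ f = ≤-trans (m≤n+m _ (∑ I₁ f)) (∑I₁R≤ f)

  ∑Y≤ : (g : ℕ → ℕ) → ∑ Y g ≤ ∑ S g
  ∑Y≤ = ∑-filter-≤ (_<? a) S

  ∑Z≤ : (g : ℕ → ℕ) → ∑ Z g ≤ ∑ S g
  ∑Z≤ g = ≤-trans (m≤m+n _ _) (≤-trans (m≤n+m _ (∑ Y g)) (≤-reflexive (sym (∑S g))))

  ∑S₁ : (g : ℕ → ℕ) → ∑ S₁ g ≡ ∑ R (g ∘ proj₁) + ∑ Y g
  ∑S₁ g = trans (∑-++ (map proj₁ R) Y g) (cong (_+ ∑ Y g) (∑-map proj₁ R g))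

  ∑S₂ : (g : ℕ → ℕ) → ∑ S₂ g ≡ ∑ Z g + ∑ X (g ∘ proj₂)
  ∑S₂ g = trans (∑-++ Z (map proj₂ X) g) (cong (∑ Z g +_) (∑-map proj₂ X g))

  -- A chord of `R` ends after `a`, beyond every chord of `I₁`, so passing over its inner end is a
  -- genuine crossing. For this reason loads do not grow when the chords of `R` are replaced by
  -- their ends; `over-hi` is the same on the right.
  over-lo : ∀ {e} → e ∈ I₁ → ∑ R (over e ∘ proj₁) ≤ ∑ R (cross e)
  over-lo e∈ = ∑-mono R λ f∈ →
    over≤crossʳ (≤-<-trans (proj₂ (I₁⊆ e∈)) (proj₁ (proj₂ (proj₂ (R⊆ f∈)))))

  over-hi : ∀ {e} → e ∈ I₂ → ∑ X (over e ∘ proj₂) ≤ ∑ R (λ f → cross f e)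
  over-hi {e} e∈ = ≤-trans (∑-filter-≤ (∁? toJ?) R (over e ∘ proj₂)) (∑-mono R λ {f} f∈ →
    over≤crossˡ {q = proj₂ e} {t = proj₂ f} (<-≤-trans (proj₂ (proj₁ (proj₂ (R⊆ f∈)))) (proj₂ (I₂⊆ e∈))))

  a≡1+i⇒[] : a ≡ suc i → length R + length Y ≡ 0
  a≡1+i⇒[] refl = cong₂ _+_ (empty R λ e∈ → let _ , (i<l , l<a) , _ = R⊆ e∈ in <-≤-trans i<l (s≤s⁻¹ l<a))
                            (empty Y λ o∈ → let o∈S , o<a = Y⊆ o∈ in <-≤-trans (proj₁ (inner o∈S)) (s≤s⁻¹ o<a))
    where
    empty : ∀ {A : Set} (xs : List A) → (∀ {x} → x ∈ xs → i < i) → length xs ≡ 0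
    empty []       _    = refl
    empty (x ∷ xs) none = contradiction (none (here refl)) (<-irrefl refl)

  -- If (i , a) is a chord, everything in `R` and `Y` crosses it, and its load is at most 3.
  -- Otherwise `a` is next to `i`, and no vertex lies between them from which a chord could leave.
  few₁ : length R + length Y ≤ 3
  few₁ = [ (λ a≡1+i → ≤-trans (≤-reflexive (a≡1+i⇒[] a≡1+i)) z≤n) , few-base ]′ attained
    where
    open ≤-Reasoning
    few-base : (i , a) ∈ I → length R + length Y ≤ 3
    few-base ia∈I = begin
      length R + length Y
        ≤⟨ +-mono-≤ (length≤∑ R λ f∈ → let _ , (i<l , l<a) , (a<h , _) = R⊆ f∈ in cross≥1 i<l l<a a<h)
                    (length≤∑ Y λ o∈ → let o∈S , o<a = Y⊆ o∈ in over≥1 (proj₁ (inner o∈S)) o<a) ⟩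
      ∑ R (cross (i , a)) + ∑ Y (over (i , a))
        ≤⟨ +-mono-≤ (≤-trans (∑R≤ _) (m≤m+n _ _)) (∑Y≤ _) ⟩
      load (i , a) I S
        ≤⟨ light ia∈I ⟩
      3 ∎

  -- The same argument on the right, but here the membership has to be assumed. Chords of `V` share
  -- the end `j` with (a , j), so only `X` counts.
  few₂ : (a , j) ∈ I → length Z + length X ≤ 3
  few₂ aj∈I = begin
    length Z + length X
      ≤⟨ +-mono-≤ (length≤∑ Z λ o∈ → let o∈S , a<o = Z⊆ o∈ in over≥1 a<o (proj₂ (inner o∈S)))
                  (length≤∑ X λ f∈ → let f∈R , h<j = X⊆ f∈ ; _ , (_ , l<a) , (a<h , _) = R⊆ f∈R in
                                      cross≥1 l<a a<h h<j) ⟩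
    ∑ Z (over (a , j)) + ∑ X (λ f → cross f (a , j))
      ≤⟨ +-mono-≤ (∑Z≤ _) (≤-trans (∑-filter-≤ (∁? toJ?) R _) (∑R≤ _)) ⟩
    ∑ S (over (a , j)) + ∑ I (λ f → cross f (a , j))
      ≡⟨ +-comm (∑ S (over (a , j))) _ ⟩
    ∑ I (λ f → cross f (a , j)) + ∑ S (over (a , j))
      ≤⟨ +-monoˡ-≤ _ (m≤n+m _ (∑ I (cross (a , j)))) ⟩
    load (a , j) I S
      ≤⟨ light aj∈I ⟩
    3 ∎
    where open ≤-Reasoning

  window₁ : Window i a I₁ S₁
  window₁ = record
    { unique = Unique.filter⁺ left? unique
    ; within = λ e∈ → let e∈I , h≤a = I₁⊆ e∈ ; i≤l , l<h , _ = within e∈I in i≤l , l<h , h≤a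
    ; inner  = inner₁
    ; few    = ≤-trans (≤-reflexive length-S₁) few₁
    ; light  = light₁
    }
    where
    inner₁ : ∀ {o} → o ∈ S₁ → i < o × o < a
    inner₁ o∈ with ∈-++⁻ (map proj₁ R) o∈
    ... | inj₁ o∈R with e , e∈R , refl ← ∈-map⁻ proj₁ o∈R = proj₁ (proj₂ (R⊆ e∈R))
    ... | inj₂ o∈Y = let o∈S , o<a = Y⊆ o∈Y in proj₁ (inner o∈S) , o<a
    open ≤-Reasoning
    light₁ : ∀ {e} → e ∈ I₁ → load e I₁ S₁ ≤ 3
    light₁ {e} e∈ = begin
      ∑ I₁ (cross e) + ∑ I₁ (λ f → cross f e) + ∑ S₁ (over e)
        ≡⟨ cong (∑ I₁ (cross e) + ∑ I₁ (λ f → cross f e) +_) (∑S₁ (over e)) ⟩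
      ∑ I₁ (cross e) + ∑ I₁ (λ f → cross f e) + (∑ R (over e ∘ proj₁) + ∑ Y (over e))
        ≤⟨ +-mono-≤ (+-monoʳ-≤ (∑ I₁ (cross e)) (∑I₁≤ _)) (+-mono-≤ (over-lo e∈) (∑Y≤ _)) ⟩
      ∑ I₁ (cross e) + ∑ I (λ f → cross f e) + (∑ R (cross e) + ∑ S (over e))
        ≡⟨ shuffle (∑ I₁ (cross e)) _ (∑ R (cross e)) _ ⟩
      (∑ I₁ (cross e) + ∑ R (cross e)) + ∑ I (λ f → cross f e) + ∑ S (over e)
        ≤⟨ +-monoˡ-≤ _ (+-monoˡ-≤ _ (∑I₁R≤ (cross e))) ⟩
      load e I S
        ≤⟨ light (proj₁ (I₁⊆ e∈)) ⟩
      3 ∎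
      where
      shuffle : ∀ p q r s → p + q + (r + s) ≡ p + r + q + s
      shuffle = solve-∀

  -- `S₂` may have more than three elements, which a `Window` does not admit; `T` is either all of
  -- it or a part of length three.
  window₂ : ∀ {T} → T ⊆ S₂ → (∀ g → ∑ T g ≤ ∑ S₂ g) → length T ≤ 3 → Window a j I₂ T
  window₂ {T} T⊆ ∑T≤ few₂ = record
    { unique = Unique.filter⁺ right? (Unique.filter⁺ (∁? left?) unique)
    ; within = λ e∈ → let e∈I , a≤l = I₂⊆ e∈ ; _ , l<h , h≤j = within e∈I in a≤l , l<h , h≤j
    ; inner  = inner₂ ∘ T⊆
    ; few    = few₂
    ; light  = light₂
    }
    where
    inner₂ : ∀ {o} → o ∈ S₂ → a < o × o < j
    inner₂ o∈ with ∈-++⁻ Z o∈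
    ... | inj₁ o∈Z = let o∈S , a<o = Z⊆ o∈Z in a<o , proj₂ (inner o∈S)
    ... | inj₂ o∈X with e , e∈X , refl ← ∈-map⁻ proj₂ o∈X =
      let e∈R , h<j = X⊆ e∈X in proj₁ (proj₂ (proj₂ (R⊆ e∈R))) , h<j
    open ≤-Reasoning
    light₂ : ∀ {e} → e ∈ I₂ → load e I₂ T ≤ 3
    light₂ {e} e∈ = begin
      ∑ I₂ (cross e) + ∑ I₂ (λ f → cross f e) + ∑ T (over e)
        ≤⟨ +-monoʳ-≤ (∑ I₂ (cross e) + ∑ I₂ (λ f → cross f e))
             (≤-trans (∑T≤ (over e)) (≤-reflexive (∑S₂ (over e)))) ⟩
      ∑ I₂ (cross e) + ∑ I₂ (λ f → cross f e) + (∑ Z (over e) + ∑ X (over e ∘ proj₂))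
        ≤⟨ +-mono-≤ (+-monoˡ-≤ _ (∑I₂≤ (cross e))) (+-mono-≤ (∑Z≤ _) (over-hi e∈)) ⟩
      ∑ I (cross e) + ∑ I₂ (λ f → cross f e) + (∑ S (over e) + ∑ R (λ f → cross f e))
        ≡⟨ shuffle (∑ I (cross e)) _ _ (∑ R (λ f → cross f e)) ⟩
      ∑ I (cross e) + (∑ I₂ (λ f → cross f e) + ∑ R (λ f → cross f e)) + ∑ S (over e)
        ≤⟨ +-monoˡ-≤ _ (+-monoʳ-≤ (∑ I (cross e)) (∑I₂R≤ (λ f → cross f e))) ⟩
      load e I S
        ≤⟨ light (proj₁ (I₂⊆ e∈)) ⟩
      3 ∎
      where
      shuffle : ∀ p q r s → p + q + (r + s) ≡ p + (q + s) + r
      shuffle = solve-∀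

  -- Every chord of R passes over a, and those ending at j also pass over Z.
  crossings-≥ : (cr I₁ I₁ + st I₁ S₁) + (cr I₂ I₂ + st I₂ S₂) + (length W₀ * length R + length V * length Z)
              ≤ cr I I + st I S
  crossings-≥ = begin
    (cr I₁ I₁ + st I₁ S₁) + (cr I₂ I₂ + st I₂ S₂) + (w * r + v * z)
      ≤⟨ +-monoˡ-≤ _ (+-mono-≤ (+-monoʳ-≤ (cr I₁ I₁) st₁) (+-monoʳ-≤ (cr I₂ I₂) st₂)) ⟩
    (cr I₁ I₁ + (cr I₁ R + st I₁ Y)) + (cr I₂ I₂ + (cr R I₂ + st I₂ Z)) + (w * r + v * z)
      ≡⟨ shuffle (cr I₁ I₁) (cr I₁ R) (st I₁ Y) (cr I₂ I₂) (cr R I₂) (st I₂ Z) (w * r + v * z) ⟩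
    ((cr I₁ I₁ + cr I₁ R) + (cr I₂ I₂ + cr R I₂)) + (st I₁ Y + (st I₂ Z + (w * r + v * z)))
      ≤⟨ +-mono-≤ cr≤ (≤-trans (+-mono-≤ (∑-mono I₁ (λ {e} _ → ∑Y≤ (over e)))
           (+-mono-≤ (∑-mono I₂ (λ {e} _ → ∑Z≤ (over e))) stR)) (≤-reflexive (sym (∑I _)))) ⟩
    cr I I + st I S ∎
    where
    open ≤-Reasoning
    w = length W₀
    r = length R
    v = length V
    z = length Z
    shuffle : ∀ a b c d e f g → (a + (b + c)) + (d + (e + f)) + g ≡ ((a + b) + (d + e)) + (c + (f + g))
    shuffle = solve-∀

    st₁ : st I₁ S₁ ≤ cr I₁ R + st I₁ Y
    st₁ = begin
      ∑ I₁ (λ e → ∑ S₁ (over e))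
        ≡⟨ ∑-cong I₁ (λ e → ∑S₁ (over e)) ⟩
      ∑ I₁ (λ e → ∑ R (over e ∘ proj₁) + ∑ Y (over e))
        ≡⟨ ∑-+ I₁ _ _ ⟩
      ∑ I₁ (λ e → ∑ R (over e ∘ proj₁)) + st I₁ Y
        ≤⟨ +-monoˡ-≤ _ (∑-mono I₁ over-lo) ⟩
      cr I₁ R + st I₁ Y ∎

    st₂ : st I₂ S₂ ≤ cr R I₂ + st I₂ Z
    st₂ = begin
      ∑ I₂ (λ e → ∑ S₂ (over e))
        ≡⟨ ∑-cong I₂ (λ e → ∑S₂ (over e)) ⟩
      ∑ I₂ (λ e → ∑ Z (over e) + ∑ X (over e ∘ proj₂))
        ≡⟨ ∑-+ I₂ _ _ ⟩
      st I₂ Z + ∑ I₂ (λ e → ∑ X (over e ∘ proj₂))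
        ≤⟨ +-monoʳ-≤ (st I₂ Z) (∑-mono I₂ over-hi) ⟩
      st I₂ Z + ∑ I₂ (λ e → ∑ R (λ f → cross f e))
        ≡⟨ cong (st I₂ Z +_) (∑-swap I₂ R (λ e f → cross f e)) ⟩
      st I₂ Z + cr R I₂
        ≡⟨ +-comm (st I₂ Z) _ ⟩
      cr R I₂ + st I₂ Z ∎

    -- The four families of ordered pairs are disjoint. In a crossing with `R`, a chord of `I₁`
    -- always comes first and a chord of `I₂` second; crossings inside `R` are given away.
    cr≤ : (cr I₁ I₁ + cr I₁ R) + (cr I₂ I₂ + cr R I₂) ≤ cr I I
    cr≤ = begin
      (cr I₁ I₁ + cr I₁ R) + (cr I₂ I₂ + cr R I₂)
        ≡⟨ cong (_+ (cr I₂ I₂ + cr R I₂)) (∑-+ I₁ _ _) ⟨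
      ∑ I₁ (λ e → ∑ I₁ (cross e) + ∑ R (cross e)) + (cr I₂ I₂ + cr R I₂)
        ≤⟨ +-mono-≤ (∑-mono I₁ (λ {e} _ → ∑I₁R≤ (cross e)))
             (+-mono-≤ (∑-mono I₂ (λ {e} _ → ∑I₂≤ (cross e))) (∑-mono R (λ {e} _ → ∑I₂≤ (cross e)))) ⟩
      cr I₁ I + (cr I₂ I + cr R I)
        ≡⟨ ∑I (λ e → ∑ I (cross e)) ⟨
      cr I I ∎

    stR : w * r + v * z ≤ st R S
    stR = begin
      w * r + v * z
        ≡⟨ cong₂ _+_ (*-comm w r) refl ⟩
      r * w + v * z
        ≡⟨ cong₂ _+_ (∑-const R w) (∑-const V z) ⟨
      ∑ R (const w) + ∑ V (const z)
        ≤⟨ +-mono-≤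
             (∑-mono R λ e∈ → length≤∑ W₀ λ o∈ → let _ , (_ , l<a) , (a<h , _) = R⊆ e∈ ; o≡a = W₀⊆ o∈ in
                over≥1 (<-≤-trans l<a (≤-reflexive (sym o≡a))) (≤-<-trans (≤-reflexive o≡a) a<h))
             (∑-mono V λ e∈ → length≤∑ Z λ o∈ → let e∈R , h≡j = V⊆ e∈ ; _ , (_ , l<a) , _ = R⊆ e∈R
                                                    o∈S , a<o = Z⊆ o∈ in
                over≥1 (<-trans l<a a<o) (<-≤-trans (proj₂ (inner o∈S)) (≤-reflexive (sym h≡j)))) ⟩
      st R W₀ + st V Z
        ≤⟨ +-monoʳ-≤ (st R W₀) (∑-filter-≤ toJ? R _) ⟩
      st R W₀ + st R Z
        ≡⟨ +-comm (st R W₀) _ ⟩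
      st R Z + st R W₀
        ≡⟨ ∑-+ R _ _ ⟨
      ∑ R (λ e → ∑ Z (over e) + ∑ W₀ (over e))
        ≤⟨ ∑-mono R (λ {e} _ → ≤-trans (m≤n+m _ (∑ Y (over e))) (≤-reflexive (sym (∑S (over e))))) ⟩
      st R S ∎

-- The induction step

∑-take : {A : Set} (n : ℕ) (xs : List A) (f : A → ℕ) → ∑ (take n xs) f ≤ ∑ xs f
∑-take n xs f = begin
  ∑ (take n xs) f                      ≤⟨ m≤m+n _ _ ⟩
  ∑ (take n xs) f + ∑ (drop n xs) f    ≡⟨ ∑-++ (take n xs) (drop n xs) f ⟨
  ∑ (take n xs ++ drop n xs) f         ≡⟨ cong (λ ys → ∑ ys f) (take++drop≡id n xs) ⟩
  ∑ xs f                               ∎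
  where open ≤-Reasoning

take-⊆ : {A : Set} (n : ℕ) (xs : List A) → take n xs ⊆ xs
take-⊆ n xs x∈ = subst (_ ∈_) (take++drop≡id n xs) (∈-++⁺ˡ x∈)

⊆-take-++ : {A : Set} {n : ℕ} {xs ys : List A} → length xs ≤ n → xs ⊆ take n (xs ++ ys)
⊆-take-++ (s≤s _)   (here refl) = here refl
⊆-take-++ (s≤s len) (there x∈)  = there (⊆-take-++ len x∈)

stub⇒gap : ∀ {i j I S m} → j ≡ suc (m + i) → Window i j I S → 1 ≤ length S → ∃[ m′ ] m ≡ suc m′
stub⇒gap {S = o ∷ S} {zero}  refl W _ = let i<o , o<1+i = Window.inner W (here refl) in
  contradiction (<-≤-trans i<o (s≤s⁻¹ o<1+i)) (<-irrefl refl)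
stub⇒gap {m = suc m′} _ _ _ = m′ , refl

module Combine {i a j : ℕ} {I : List Chord} {S : List ℕ} (W : Window i j I S) (b∉I : (i , j) ∉ I)
  (i<a : i < a) (a<j : a < j) (attained : a ≡ suc i ⊎ (i , a) ∈ I)
  (bound : ∀ {e} → e ∈ I → proj₁ e ≡ i → proj₂ e ≤ a) where

  open Window W
  open Split W b∉I i<a a<j attained bound

  x = length X
  v = length V
  y = length Y
  w = length W₀
  z = length Z
  r = length R
  dO = δ (map proj₁ X)
  dT = δ (map proj₂ X)
  cost = Cost x v y w z (δ Y) (δ Z) dO dT
  gain = Gain x v y w z (δ Y) dO

  X-unique : Unique X
  X-unique = Unique.filter⁺ _ (Unique.filter⁺ _ (Unique.filter⁺ _ unique))

  V-unique : Unique V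
  V-unique = Unique.filter⁺ _ (Unique.filter⁺ _ (Unique.filter⁺ _ unique))

  -- The chords of `V` all end at `j`, so their origins are distinct.
  v≤δ : v ≤ δ (map proj₁ V)
  v≤δ = begin
    v                                   ≤⟨ unique⇒length≤δ*δ V-unique ⟩
    δ (map proj₁ V) * δ (map proj₂ V)   ≤⟨ *-monoʳ-≤ (δ (map proj₁ V)) (δ≤ {T = j ∷ []} hi⊆) ⟩
    δ (map proj₁ V) * 1                 ≡⟨ *-identityʳ _ ⟩
    δ (map proj₁ V)                     ∎
    where
    open ≤-Reasoning
    hi⊆ : map proj₂ V ⊆ j ∷ []
    hi⊆ o∈ with e , e∈V , refl ← ∈-map⁻ proj₂ o∈ = here (proj₂ (V⊆ e∈V))

  S⊆ : S ⊆ (Y ++ W₀) ++ Z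
  S⊆ {o} o∈ with o <? a | a <? o
  ... | yes o<a | _       = ∈-++⁺ˡ (∈-++⁺ˡ (∈-filter⁺ (_<? a) o∈ o<a))
  ... | no o≮a  | yes a<o = ∈-++⁺ʳ (Y ++ W₀) (∈-filter⁺ (a <?_) (∈-filter⁺ (∁? (_<? a)) o∈ o≮a) a<o)
  ... | no o≮a  | no a≮o  =
    ∈-++⁺ˡ (∈-++⁺ʳ Y (∈-filter⁺ (∁? (a <?_)) (∈-filter⁺ (∁? (_<? a)) o∈ o≮a) a≮o))

  δS≤ : δ S ≤ δ Y + 1 ⊓ w + δ Z
  δS≤ = begin
    δ S                    ≤⟨ δ-⊆ S⊆ ⟩
    δ ((Y ++ W₀) ++ Z)     ≤⟨ δ-++ (Y ++ W₀) Z ⟩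
    δ (Y ++ W₀) + δ Z      ≤⟨ +-monoˡ-≤ _ (δ-++ Y W₀) ⟩
    δ Y + δ W₀ + δ Z       ≤⟨ +-monoˡ-≤ _ (+-monoʳ-≤ (δ Y)
                                (⊓-glb (δ≤ {T = a ∷ []} (here ∘ W₀⊆)) (δ≤ {W₀} id))) ⟩
    δ Y + 1 ⊓ w + δ Z      ∎
    where open ≤-Reasoning

  r≡ : r ≡ x + v
  r≡ = trans length-R (+-comm v x)

  cost-≥ : 8 * r + β (length S) (δ S) ≤ cost
  cost-≥ = +-mono-≤ (≤-reflexive (cong (8 *_) r≡)) (begin
    β (length S) (δ S)                        ≤⟨ β-mono (length S) δS≤ ⟩
    β (length S) (δ Y + 1 ⊓ w + δ Z)          ≡⟨ cong (λ b → β b (δ Y + 1 ⊓ w + δ Z)) length-S′ ⟩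
    β (y + w + z) (δ Y + 1 ⊓ w + δ Z)         ∎)
    where
    open ≤-Reasoning
    length-S′ : length S ≡ y + w + z
    length-S′ = trans length-S (trans (cong (y +_) (+-comm z w)) (sym (+-assoc y w z)))

  -- A maximum rather than a sum, because the origins of `X` and `V` and the vertices of `Y` may
  -- coincide.
  S₁-⊇ : dO ⊔ v ⊔ δ Y ≤ δ S₁
  S₁-⊇ = ⊔-lub (⊔-lub (δ-⊆ X⊆S₁) (≤-trans v≤δ (δ-⊆ V⊆S₁))) (δ-⊆ {Y} {S₁} (∈-++⁺ʳ (map proj₁ R)))
    where
    X⊆S₁ : map proj₁ X ⊆ S₁
    X⊆S₁ o∈ with e , e∈X , refl ← ∈-map⁻ proj₁ o∈ = ∈-++⁺ˡ (∈-map⁺ proj₁ (proj₁ (X⊆ e∈X)))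
    V⊆S₁ : map proj₁ V ⊆ S₁
    V⊆S₁ o∈ with e , e∈V , refl ← ∈-map⁻ proj₁ o∈ = ∈-++⁺ˡ (∈-map⁺ proj₁ (proj₁ (V⊆ e∈V)))

  length-S₁′ : length S₁ ≡ x + v + y
  length-S₁′ = trans length-S₁ (cong (_+ y) r≡)

  gain-≤ : gain ≤ γ (length S₁) (δ S₁) + 2 * (w * r + v * z)
  gain-≤ = +-mono-≤
    (begin
      γ (x + v + y) (dO ⊔ v ⊔ δ Y)   ≤⟨ +-monoˡ-≤ _ (β-mono (x + v + y) S₁-⊇) ⟩
      γ (x + v + y) (δ S₁)           ≡⟨ cong (λ b → γ b (δ S₁)) length-S₁′ ⟨
      γ (length S₁) (δ S₁)           ∎)
    (≤-reflexive (cong (λ n → 2 * (w * n + v * z)) (sym r≡)))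
    where open ≤-Reasoning

  z≤3 : z ≤ 3
  z≤3 = ≤-trans (m≤m+n z w) (≤-trans (m≤n+m _ y) (≤-trans (≤-reflexive (sym length-S)) few))

  -- The check is finite because `few₁` bounds x + v + y by 3 and `few` bounds y + w + z by 3.
  balanced : Balanced x v y w z (δ Y) (δ Z) dO dT
  balanced = table
    (s≤s (≤-trans (m≤m+n x (v + y)) x+vy≤3))
    (m+n≤o⇒m≤o∸n (suc v) (s≤s (≤-trans (≤-reflexive (+-comm v x)) (≤-trans (+-monoʳ-≤ x (m≤m+n v y)) x+vy≤3))))
    (m+n≤o⇒m≤o∸n (suc y) (m+n≤o⇒m≤o∸n (suc y + v)
      (s≤s (≤-trans (≤-reflexive (trans (+-comm (y + v) x) (cong (x +_) (+-comm y v)))) x+vy≤3))))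
    (m+n≤o⇒m≤o∸n (suc w) (s≤s (≤-trans (≤-reflexive (+-comm w y)) (≤-trans (+-monoʳ-≤ y (m≤n+m w z)) yzw≤3))))
    (m+n≤o⇒m≤o∸n (suc z) (m+n≤o⇒m≤o∸n (suc z + w)
      (s≤s (≤-trans (≤-reflexive (+-comm (z + w) y)) yzw≤3))))
    (s≤s (δ≤ {Y} id)) (s≤s (δ≤ {Z} id))
    (s≤s (≤-trans (δ≤ {map proj₁ X} id) (≤-reflexive (length-map proj₁ X))))
    (s≤s (≤-trans (δ≤ {map proj₂ X} id) (≤-reflexive (length-map proj₂ X))))
    (unique⇒length≤δ*δ X-unique)
    where
    x+vy≤3 : x + (v + y) ≤ 3
    x+vy≤3 = ≤-trans (≤-reflexive (trans (sym (+-assoc x v y)) (cong (_+ y) (sym r≡)))) few₁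
    yzw≤3 : y + (z + w) ≤ 3
    yzw≤3 = ≤-trans (≤-reflexive (sym length-S)) few

  -- The right polygon enters through an arbitrary bound with `c₂` and `g₂`, so that both ways of
  -- treating it share this computation. The 5 of the finite check and the 8 of `Strong` add up to
  -- the 13 belonging to the vertex `a`.
  combine : ∀ {c₂ g₂ m₁ m₂} →
    8 * length I₁ + γ (length S₁) (δ S₁) ≤ 2 * (cr I₁ I₁ + st I₁ S₁) + 13 * m₁ →
    8 * length I₂ + g₂ ≤ 2 * c₂ + 13 * m₂ →
    c₂ ≤ cr I₂ I₂ + st I₂ S₂ →
    cost ≤ 5 + gain + g₂ →
    8 * length I + (8 + β (length S) (δ S)) ≤ 2 * (cr I I + st I S) + 13 * suc (m₁ + m₂)
  combine {c₂} {g₂} {m₁} {m₂} H₁ H₂ c₂≤ F = begin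
    8 * length I + (8 + b)
      ≡⟨ cong (λ n → 8 * n + (8 + b)) length-I ⟩
    8 * (n₁ + (n₂ + r)) + (8 + b)
      ≡⟨ shuffle₁ n₁ n₂ r b ⟩
    8 * n₁ + 8 * n₂ + 8 + (8 * r + b)
      ≤⟨ +-monoʳ-≤ (8 * n₁ + 8 * n₂ + 8) (≤-trans cost-≥ (≤-trans F (+-monoˡ-≤ g₂ (+-monoʳ-≤ 5 gain-≤)))) ⟩
    8 * n₁ + 8 * n₂ + 8 + (5 + (g₁ + 2 * p) + g₂)
      ≡⟨ shuffle₂ (8 * n₁) (8 * n₂) g₁ p g₂ ⟩
    (8 * n₁ + g₁) + (8 * n₂ + g₂) + (2 * p + 13)
      ≤⟨ +-monoˡ-≤ _ (+-mono-≤ H₁ (≤-trans H₂ (+-monoˡ-≤ (13 * m₂) (*-monoʳ-≤ 2 c₂≤)))) ⟩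
    (2 * t₁ + 13 * m₁) + (2 * t₂ + 13 * m₂) + (2 * p + 13)
      ≡⟨ shuffle₃ t₁ m₁ t₂ m₂ p ⟩
    2 * (t₁ + t₂ + p) + 13 * suc (m₁ + m₂)
      ≤⟨ +-monoˡ-≤ _ (*-monoʳ-≤ 2 crossings-≥) ⟩
    2 * (cr I I + st I S) + 13 * suc (m₁ + m₂) ∎
    where
    open ≤-Reasoning
    b = β (length S) (δ S)
    n₁ = length I₁
    n₂ = length I₂
    g₁ = γ (length S₁) (δ S₁)
    p = w * r + v * z
    t₁ = cr I₁ I₁ + st I₁ S₁
    t₂ = cr I₂ I₂ + st I₂ S₂
    shuffle₁ : ∀ n₁ n₂ r b → 8 * (n₁ + (n₂ + r)) + (8 + b) ≡ 8 * n₁ + 8 * n₂ + 8 + (8 * r + b)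
    shuffle₁ = solve-∀
    shuffle₂ : ∀ n₁ n₂ g₁ p g₂ → n₁ + n₂ + 8 + (5 + (g₁ + 2 * p) + g₂) ≡ (n₁ + g₁) + (n₂ + g₂) + (2 * p + 13)
    shuffle₂ = solve-∀
    shuffle₃ : ∀ t₁ m₁ t₂ m₂ p → (2 * t₁ + 13 * m₁) + (2 * t₂ + 13 * m₂) + (2 * p + 13)
                               ≡ 2 * (t₁ + t₂ + p) + 13 * suc (m₁ + m₂)
    shuffle₃ = solve-∀

  step : ∀ {m₁ m₂} → a ≡ suc (m₁ + i) → j ≡ suc (m₂ + a) → Weak m₁ → Weak m₂ →
         (∀ {m′} → m₂ ≡ suc m′ → Strong m₂) →
         8 * length I + (8 + β (length S) (δ S)) ≤ 2 * (cr I I + st I S) + 13 * suc (m₁ + m₂)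
  step {m₁} {m₂} a≡ j≡ weak₁ weak₂ strong₂ with z + x ≤? 3
  ... | yes zx≤3 = combine {m₁ = m₁} {m₂} (weak₁ a≡ window₁)
    (weak₂ j≡ (window₂ id (λ _ → ≤-refl) (≤-trans (≤-reflexive length-S₂) zx≤3))) ≤-refl
    (≤-trans (proj₁ balanced zx≤3) (+-monoʳ-≤ (5 + gain) (begin
      γ (z + x) (δ Z ⊔ dT)   ≤⟨ +-monoˡ-≤ _ (β-mono (z + x)
                                  (⊔-lub (δ-⊆ {Z} {S₂} ∈-++⁺ˡ) (δ-⊆ {map proj₂ X} {S₂} (∈-++⁺ʳ Z)))) ⟩
      γ (z + x) (δ S₂)       ≡⟨ cong (λ b → γ b (δ S₂)) length-S₂ ⟨
      γ (length S₂) (δ S₂)   ∎)))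
    where open ≤-Reasoning
  -- Here (a , j) is not in I, being crossed more than three times; keeping three
  -- elements of S₂, first those of Z, is enough.
  ... | no zx≰3 = combine {m₁ = m₁} {m₂} (weak₁ a≡ window₁)
    strong
    (+-monoʳ-≤ (cr I₂ I₂) (∑-mono I₂ λ {e} _ → ∑-take 3 S₂ (over e)))
    (begin
      cost                                        ≤⟨ [ id , flip contradiction zx≰3 ]′ (proj₂ balanced) ⟩
      13 + gain + β 3 (δ Z)                       ≤⟨ +-monoʳ-≤ (13 + gain) (β-mono 3 (δ-⊆ {Z} {T} (⊆-take-++ z≤3))) ⟩
      13 + gain + β 3 (δ T)                       ≡⟨ cong (λ b → 13 + gain + β b (δ T)) length-T ⟨
      13 + gain + β (length T) (δ T)              ≡⟨ shuffle gain _ ⟩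
      5 + gain + (8 + β (length T) (δ T))         ∎)
    where
    open ≤-Reasoning
    T : List ℕ
    T = take 3 S₂
    length-T : length T ≡ 3
    length-T = trans (length-take 3 S₂) (m≤n⇒m⊓n≡m
      (≤-trans (<⇒≤ (≰⇒> zx≰3)) (≤-reflexive (sym length-S₂))))
    aj∉I₂ : (a , j) ∉ I₂
    aj∉I₂ aj∈ = zx≰3 (few₂ (proj₁ (I₂⊆ aj∈)))
    W₂ : Window a j I₂ T
    W₂ = window₂ (take-⊆ 3 S₂) (∑-take 3 S₂) (≤-reflexive length-T)
    strong : 8 * length I₂ + (8 + β (length T) (δ T)) ≤ 2 * (cr I₂ I₂ + st I₂ T) + 13 * m₂
    strong = strong₂ (proj₂ (stub⇒gap j≡ W₂ (≤-trans (s≤s z≤n) (≤-reflexive (sym length-T))))) j≡ W₂ aj∉I₂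
    shuffle : ∀ g b → 13 + g + b ≡ 5 + g + (8 + b)
    shuffle = solve-∀

gap : ∀ {p q} → p < q → q ≡ suc (q ∸ suc p + p)
gap {p} {q} p<q = trans (sym (m∸n+n≡m p<q)) (+-suc (q ∸ suc p) p)

-- `N` makes the induction on the size structural. The sizes of the two parts add up to `m`, so each
-- is below `suc m` even when the other is 0.
strong : ∀ N {m} → m < N → Strong (suc m)
strong (suc N) {m} (s≤s m≤N) {i} {j} {I} {S} j≡ W b∉I =
  let a , i<a , attained , bound = farthest i I
      a<j = a<j attained
      m≡ = split-gap i<a a<j
  in subst (λ n → 8 * length I + (8 + β (length S) (δ S)) ≤ 2 * (cr I I + st I S) + 13 * suc n) m≡
       (Combine.step W b∉I i<a a<j attained bound (gap i<a) (gap a<j)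
         (weak (≤-trans (m≤m+n _ _) (≤-reflexive m≡)))
         (weak (≤-trans (m≤n+m _ (a ∸ suc i)) (≤-reflexive m≡)))
         (strict (≤-trans (m≤n+m _ (a ∸ suc i)) (≤-reflexive m≡))))
  where
  strict : ∀ {n} → n ≤ m → ∀ {n′} → n ≡ suc n′ → Strong n
  strict n≤m refl = strong N (≤-trans n≤m m≤N)

  weak : ∀ {n} → n ≤ m → Weak n
  weak n≤m = weaken (strict n≤m)

  a<j : ∀ {a} → a ≡ suc i ⊎ (i , a) ∈ I → a < j
  a<j (inj₁ refl) = ≤-trans (s≤s (s≤s (m≤n+m i m))) (≤-reflexive (sym j≡))
  -- If `a` were `j`, the chord (i , a) would be the absent base.
  a<j (inj₂ ia∈I) = ≤∧≢⇒< (proj₂ (proj₂ (Window.within W ia∈I))) λ { refl → b∉I ia∈I }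

  split-gap : ∀ {a} → i < a → a < j → a ∸ suc i + (j ∸ suc a) ≡ m
  split-gap {a} i<a a<j = +-cancelʳ-≡ i _ _ (suc-injective (suc-injective (begin
    2 + (m₁ + m₂ + i)        ≡⟨ shuffle m₁ m₂ i ⟩
    suc (m₂ + suc (m₁ + i))  ≡⟨ cong (λ a → suc (m₂ + a)) (gap i<a) ⟨
    suc (m₂ + a)             ≡⟨ gap a<j ⟨
    j                        ≡⟨ j≡ ⟩
    2 + (m + i)              ∎)))
    where
    open ≡-Reasoning
    m₁ = a ∸ suc i
    m₂ = j ∸ suc a
    shuffle : ∀ m₁ m₂ i → 2 + (m₁ + m₂ + i) ≡ suc (m₂ + suc (m₁ + i))
    shuffle = solve-∀

-- The bound for one page

cross-self : ∀ e → cross e e ≡ 0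
cross-self (p , q) = 𝟙-no (crossing? p q p q) (<-irrefl refl ∘ proj₁)

-- Removing a chord of load at least 4 takes 8 from the left side and at least 2 · 4 from the right;
-- this is the origin of the ratio 8 : 2. `N` bounds the number of removals. Once no such chord
-- remains, `Weak` applies with no chord leaving the polygon.
convex-crossings : ∀ m N (G : List Chord) → length G ≤ N → Unique G →
  (∀ {e} → e ∈ G → 2 + proj₁ e ≤ proj₂ e × proj₂ e ≤ suc m) →
  8 * length G ≤ 2 * cr G G + 13 * m
convex-crossings m N G |G|≤N G! within with any? (λ e → 4 ≤? load e G []) G
... | no ¬heavy = begin
  8 * length G                         ≡⟨ +-identityʳ _ ⟨
  8 * length G + 0                     ≤⟨ weaken (λ { refl → strong _ ≤-refl }) (cong suc (sym (+-identityʳ m))) W ⟩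
  2 * (cr G G + st G []) + 13 * m      ≡⟨ cong (λ s → 2 * (cr G G + s) + 13 * m) (trans (∑-const G 0) (*-zeroʳ (length G))) ⟩
  2 * (cr G G + 0) + 13 * m            ≡⟨ cong (λ c → 2 * c + 13 * m) (+-identityʳ (cr G G)) ⟩
  2 * cr G G + 13 * m                  ∎
  where
  open ≤-Reasoning
  W : Window 0 (suc m) G []
  W = record
    { unique = G!
    ; within = λ e∈ → z≤n , within e∈
    ; inner  = λ ()
    ; few    = z≤n
    ; light  = λ e∈ → s≤s⁻¹ (≰⇒> λ heavy → ¬heavy (lose e∈ heavy))
    }
convex-crossings m zero    []      _     _  _      | yes ()
convex-crossings m (suc N) G |G|≤N G! within | yes heavy with b , b∈G , 4≤load ← find heavy = begin
  8 * length G                        ≤⟨ *-monoʳ-≤ 8 (length-rest G!) ⟩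
  8 * suc (length rest)               ≡⟨ *-suc 8 (length rest) ⟩
  8 + 8 * length rest                 ≤⟨ +-monoʳ-≤ 8 (convex-crossings m N rest |rest|≤N (rest-unique G!) (within ∘ rest⊆)) ⟩
  8 + (2 * cr rest rest + 13 * m)     ≤⟨ +-monoˡ-≤ _ (*-monoʳ-≤ 2 4≤) ⟩
  2 * (row + col) + (2 * cr rest rest + 13 * m)
                                      ≡⟨ shuffle row col (cr rest rest) m ⟩
  2 * (row + (col + cr rest rest)) + 13 * m
                                      ≤⟨ +-monoˡ-≤ _ (*-monoʳ-≤ 2 cr≤) ⟩
  2 * cr G G + 13 * m                 ∎
  where
  open ≤-Reasoning
  open Delete b G
  row = ∑ G (cross b)
  col = ∑ rest (λ f → cross f b)

  |rest|≤N : length rest ≤ N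
  |rest|≤N = s≤s⁻¹ (≤-trans (filter-notAll (∁? (_≟ᶜ b)) G (Any.map (λ { refl ¬refl → ¬refl refl }) b∈G)) |G|≤N)

  col≤ : ∑ G (λ f → cross f b) ≤ col
  col≤ = begin
    ∑ G (λ f → cross f b)                          ≡⟨ ∑-split (_≟ᶜ b) G _ ⟩
    ∑ (filter (_≟ᶜ b) G) (λ f → cross f b) + col   ≤⟨ +-monoˡ-≤ col (∑-mono (filter (_≟ᶜ b) G) λ f∈ →
      ≤-reflexive (trans (cong (λ e → cross e b) (proj₂ (∈-filter⁻ (_≟ᶜ b) {xs = G} f∈))) (cross-self b))) ⟩
    ∑ (filter (_≟ᶜ b) G) (const 0) + col           ≡⟨ cong (_+ col) (trans (∑-const (filter (_≟ᶜ b) G) 0) (*-zeroʳ (length (filter (_≟ᶜ b) G)))) ⟩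
    col                                            ∎

  4≤ : 4 ≤ row + col
  4≤ = ≤-trans 4≤load (≤-trans (≤-reflexive (+-identityʳ _)) (+-monoʳ-≤ row col≤))

  cr≤ : row + (col + cr rest rest) ≤ cr G G
  cr≤ = begin
    row + (col + cr rest rest)                          ≡⟨ cong (row +_) (∑-+ rest _ _) ⟨
    row + ∑ rest (λ f → cross f b + ∑ rest (cross f))   ≤⟨ +-monoʳ-≤ row (∑-mono rest λ {f} _ → ∑-rest b∈G (cross f)) ⟩
    row + cr rest G                                     ≤⟨ ∑-rest b∈G (λ f → ∑ G (cross f)) ⟩
    cr G G                                              ∎

  shuffle : ∀ r c t m → 2 * (r + c) + (2 * t + 13 * m) ≡ 2 * (r + (c + t)) + 13 * m
  shuffle = solve-∀

-- Colourings

∑-filter : {P : Pred A ℓ} (P? : Decidable P) (xs : List A) (f : A → ℕ) →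
           ∑ (filter P? xs) f ≡ ∑ xs (λ x → 𝟙 (P? x) * f x)
∑-filter P? []       f = refl
∑-filter P? (x ∷ xs) f with ih ← ∑-filter P? xs f | does (P? x)
... | true  = cong₂ _+_ (sym (+-identityʳ (f x))) ih
... | false = ih

length-filter≡ : {P : Pred A ℓ} (P? : Decidable P) (xs : List A) →
                 length (filter P? xs) ≡ ∑ xs (λ x → 𝟙 (P? x))
length-filter≡ P? xs = trans (length≡∑ (filter P? xs))
  (trans (∑-filter P? xs (const 1)) (∑-cong xs λ x → *-identityʳ (𝟙 (P? x))))

∑-cartesianProduct : (xs : List A) (ys : List B) (f : A × B → ℕ) →
  ∑ (cartesianProduct xs ys) f ≡ ∑ xs (λ x → ∑ ys (λ y → f (x , y)))
∑-cartesianProduct []       ys f = refl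
∑-cartesianProduct (x ∷ xs) ys f = trans (∑-++ (map (x ,_) ys) _ f)
  (cong₂ _+_ (∑-map (x ,_) ys f) (∑-cartesianProduct xs ys f))

∑-mapMaybe : (h : A → Maybe B) (xs : List A) (f : B → ℕ) →
             ∑ (mapMaybe h xs) f ≡ ∑ xs (maybe′ f 0 ∘ h)
∑-mapMaybe h []       f = refl
∑-mapMaybe h (x ∷ xs) f with h x
... | just y  = cong (f y +_) (∑-mapMaybe h xs f)
... | nothing = ∑-mapMaybe h xs f

∑-allFin-suc : ∀ n (f : Fin (suc n) → ℕ) → ∑ (allFin (suc n)) f ≡ f zero + ∑ (allFin n) (f ∘ suc)
∑-allFin-suc n f = cong (f zero +_)
  (trans (cong (λ xs → ∑ xs f) (sym (map-tabulate {n = n} id suc))) (∑-map suc (allFin n) f))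

∑-remove : ∀ {n} (v : Fin (suc n)) (f : Fin (suc n) → ℕ) →
           ∑ (allFin (suc n)) f ≡ f v + ∑ (allFin n) (f ∘ punchIn v)
∑-remove {n}     zero    f = ∑-allFin-suc n f
∑-remove {suc n} (suc v) f = begin
  ∑ (allFin (2 + n)) f
    ≡⟨ ∑-allFin-suc (suc n) f ⟩
  f zero + ∑ (allFin (suc n)) (f ∘ suc)
    ≡⟨ cong (f zero +_) (∑-remove v (f ∘ suc)) ⟩
  f zero + (f (suc v) + ∑ (allFin n) (f ∘ suc ∘ punchIn v))
    ≡⟨ x∙yz≈y∙xz (f zero) (f (suc v)) _ ⟩
  f (suc v) + (f zero + ∑ (allFin n) (f ∘ suc ∘ punchIn v))
    ≡⟨ cong (f (suc v) +_) (∑-allFin-suc n (f ∘ punchIn (suc v))) ⟨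
  f (suc v) + ∑ (allFin (suc n)) (f ∘ punchIn (suc v)) ∎
  where
  open ≡-Reasoning

∑-indicator : ∀ {k} (x : Fin k) c → ∑ (allFin k) (λ p → 𝟙 (x Fin.≟ p) * c) ≡ c
∑-indicator {suc k} x c = begin
  ∑ (allFin (suc k)) (λ p → 𝟙 (x Fin.≟ p) * c)
    ≡⟨ ∑-remove x (λ p → 𝟙 (x Fin.≟ p) * c) ⟩
  𝟙 (x Fin.≟ x) * c + ∑ (allFin k) (λ p → 𝟙 (x Fin.≟ punchIn x p) * c)
    ≡⟨ cong₂ _+_ (cong (_* c) (𝟙-yes (x Fin.≟ x) refl))
         (trans (∑-cong (allFin k) λ p → cong (_* c) (𝟙-no (x Fin.≟ punchIn x p) (punchInᵢ≢i x p ∘ sym)))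
                (trans (∑-const (allFin k) 0) (*-zeroʳ (length (allFin k))))) ⟩
  1 * c + 0
    ≡⟨ trans (+-identityʳ _) (*-identityˡ c) ⟩
  c ∎
  where open ≡-Reasoning

∑-fibres : ∀ {k} (χ : A → Fin k) (xs : List A) (f : A → ℕ) →
  ∑ (allFin k) (λ p → ∑ (filter (λ x → χ x Fin.≟ p) xs) f) ≡ ∑ xs f
∑-fibres {k = k} χ xs f = begin
  ∑ (allFin k) (λ p → ∑ (filter (λ x → χ x Fin.≟ p) xs) f)
    ≡⟨ ∑-cong (allFin k) (λ p → ∑-filter (λ x → χ x Fin.≟ p) xs f) ⟩
  ∑ (allFin k) (λ p → ∑ xs (λ x → 𝟙 (χ x Fin.≟ p) * f x))
    ≡⟨ ∑-swap (allFin k) xs _ ⟩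
  ∑ xs (λ x → ∑ (allFin k) (λ p → 𝟙 (χ x Fin.≟ p) * f x))
    ≡⟨ ∑-cong xs (λ x → ∑-indicator (χ x) (f x)) ⟩
  ∑ xs f ∎
  where open ≡-Reasoning

∈-mapMaybe⁻ : (h : A → Maybe B) (xs : List A) {y : B} → y ∈ mapMaybe h xs → ∃[ x ] x ∈ xs × h x ≡ just y
∈-mapMaybe⁻ h (x ∷ xs) y∈ with h x in hx | y∈
... | nothing | y∈′        = let x′ , x′∈ , eq = ∈-mapMaybe⁻ h xs y∈′ in x′ , there x′∈ , eq
... | just _  | here refl  = x , here refl , hx
... | just _  | there y∈′  = let x′ , x′∈ , eq = ∈-mapMaybe⁻ h xs y∈′ in x′ , there x′∈ , eq

mapMaybe-unique : (h : A → Maybe B) → (∀ {x x′ y} → h x ≡ just y → h x′ ≡ just y → x ≡ x′) →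
                  {xs : List A} → Unique xs → Unique (mapMaybe h xs)
mapMaybe-unique h inj []                 = []
mapMaybe-unique h inj {x ∷ xs} (x∉ ∷ xs!) with h x in hx
... | nothing = mapMaybe-unique h inj xs!
... | just y  = All.tabulate (λ { y∈ refl → let x′ , x′∈ , hx′ = ∈-mapMaybe⁻ h xs y∈ in
                                   All.lookup x∉ x′∈ (inj hx hx′) })
                ∷ mapMaybe-unique h inj xs!

toEdge-endpoints : ∀ {n} (ij : Fin n × Fin n) {e} → toEdge ij ≡ just e → ij ≡ (lo e , hi e)
toEdge-endpoints (i , j) eq with i Fin.<? j
toEdge-endpoints (i , j) refl | yes _ = refl

edges-unique : ∀ n → Unique (edges n)
edges-unique n = mapMaybe-unique toEdge
  (λ {x} {x′} eq eq′ → trans (toEdge-endpoints x eq) (sym (toEdge-endpoints x′ eq′)))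
  (Unique.cartesianProduct⁺ (Unique.allFin⁺ n) (Unique.allFin⁺ n))

∑-edges : ∀ n (f : Edge n → ℕ) →
  ∑ (edges n) f ≡ ∑ (allFin n) (λ i → ∑ (allFin n) (λ j → maybe′ f 0 (toEdge (i , j))))
∑-edges n f = trans (∑-mapMaybe toEdge (cartesianProduct (allFin n) (allFin n)) f) (∑-cartesianProduct (allFin n) (allFin n) _)

crossings≡∑ : ∀ {k n} (χ : Colouring k n) →
  crossings χ ≡ ∑ (edges n) (λ e → ∑ (edges n) (λ f → 𝟙 (monochromaticCrossing? χ (e , f))))
crossings≡∑ {n = n} χ = trans (length-filter≡ (monochromaticCrossing? χ) (cartesianProduct (edges n) (edges n)))
  (∑-cartesianProduct (edges n) (edges n) _)

chord : ∀ {n} → Edge n → Chord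
chord e = toℕ (lo e) , toℕ (hi e)

chord-injective : ∀ {n} {e f : Edge n} → chord e ≡ chord f → e ≡ f
chord-injective {e = edge a b _} {edge c d _} eq
  with refl ← toℕ-injective {i = a} {c} (cong proj₁ eq)
  with refl ← toℕ-injective {i = b} {d} (cong proj₂ eq) = refl

long? : ∀ {n} (e : Edge n) → Dec (2 + toℕ (lo e) ≤ toℕ (hi e))
long? e = 2 + toℕ (lo e) ≤? toℕ (hi e)

-- The edge from the first to the last vertex is included although it is a side, just as a `Window`
-- may contain its base. The count is therefore C(n - 1 , 2), one more than the number of true
-- diagonals.
diagonals : ∀ n → List (Edge n)
diagonals n = filter long? (edges n)

gap? : ∀ {n} (i j : Fin n) → Dec (2 + toℕ i ≤ toℕ j)
gap? i j = 2 + toℕ i ≤? toℕ j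

pairs : ℕ → ℕ
pairs n = ∑ (allFin n) λ i → ∑ (allFin n) λ j → 𝟙 (gap? i j)

pairs≤diagonals : ∀ n → pairs n ≤ length (diagonals n)
pairs≤diagonals n = begin
  pairs n                                          ≤⟨ ∑-mono (allFin n) (λ {i} _ → ∑-mono (allFin n) (λ {j} _ → pointwise i j)) ⟩
  ∑ (allFin n) (λ i → ∑ (allFin n) (λ j → maybe′ (λ e → 𝟙 (long? e)) 0 (toEdge (i , j))))
                                                   ≡⟨ ∑-edges n (λ e → 𝟙 (long? e)) ⟨
  ∑ (edges n) (λ e → 𝟙 (long? e))                  ≡⟨ length-filter≡ long? (edges n) ⟨
  length (diagonals n)                             ∎
  where
  open ≤-Reasoning
  pointwise : ∀ i j → 𝟙 (gap? i j) ≤ maybe′ (λ e → 𝟙 (long? e)) 0 (toEdge (i , j))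
  pointwise i j with i Fin.<? j
  ... | yes _  = ≤-refl
  ... | no i≮j = ≤-reflexive (𝟙-no (gap? i j) (i≮j ∘ <-trans (n<1+n _)))

pairs-suc : ∀ m → pairs (2 + m) ≡ m + pairs (1 + m)
pairs-suc m = begin
  pairs (2 + m)
    ≡⟨ ∑-allFin-suc (suc m) (λ i → ∑ (allFin (2 + m)) λ j → 𝟙 (gap? i j)) ⟩
  ∑ (allFin (2 + m)) (λ j → 𝟙 (2 ≤? toℕ j)) +
    ∑ (allFin (suc m)) (λ i → ∑ (allFin (2 + m)) λ j → 𝟙 (gap? (suc i) j))
    ≡⟨ cong₂ _+_ first (∑-cong (allFin (suc m)) λ i → ∑-allFin-suc (suc m) (λ j → 𝟙 (gap? (suc i) j))) ⟩
  m + pairs (1 + m) ∎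
  where
  open ≡-Reasoning
  first : ∑ (allFin (2 + m)) (λ j → 𝟙 (2 ≤? toℕ j)) ≡ m
  first = begin
    ∑ (allFin (2 + m)) (λ j → 𝟙 (2 ≤? toℕ j))
      ≡⟨ ∑-allFin-suc (suc m) (λ j → 𝟙 (2 ≤? toℕ j)) ⟩
    ∑ (allFin (1 + m)) (λ j → 𝟙 (2 ≤? suc (toℕ j)))
      ≡⟨ ∑-allFin-suc m (λ j → 𝟙 (2 ≤? suc (toℕ j))) ⟩
    ∑ (allFin m) (const 1)
      ≡⟨ length≡∑ (allFin m) ⟨
    length (allFin m)
      ≡⟨ length-tabulate id ⟩
    m ∎

2*pairs : ∀ m → 2 * pairs (2 + m) ≡ m * suc m
2*pairs zero    = refl
2*pairs (suc m) = begin
  2 * pairs (3 + m)             ≡⟨ cong (2 *_) (pairs-suc (suc m)) ⟩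
  2 * (suc m + pairs (2 + m))   ≡⟨ *-distribˡ-+ 2 (suc m) _ ⟩
  2 * suc m + 2 * pairs (2 + m) ≡⟨ cong (2 * suc m +_) (2*pairs m) ⟩
  2 * suc m + m * suc m         ≡⟨ shuffle m ⟩
  suc m * suc (suc m)           ∎
  where
  open ≡-Reasoning
  shuffle : ∀ m → 2 * suc m + m * suc m ≡ suc m * suc (suc m)
  shuffle = solve-∀

-- The page bound is summed over the colours: each diagonal lies in one page, crossings within a
-- page are monochromatic, and 13m is paid once per page. The left side is 8 times `pairs (2 + m)`.
crossings-≥ : ∀ {k} m (χ : Colouring k (2 + m)) → 4 * (m * suc m) ≤ 2 * crossings χ + k * (13 * m)
crossings-≥ {k} m χ = begin
  4 * (m * suc m)
    ≡⟨ cong (4 *_) (2*pairs m) ⟨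
  4 * (2 * pairs n)
    ≡⟨ *-assoc 4 2 (pairs n) ⟨
  8 * pairs n
    ≤⟨ *-monoʳ-≤ 8 (pairs≤diagonals n) ⟩
  8 * length (diagonals n)
    ≡⟨ trans (*-comm 8 (length (diagonals n))) (sym (∑-const (diagonals n) 8)) ⟩
  ∑ (diagonals n) (const 8)
    ≡⟨ ∑-fibres χ (diagonals n) (const 8) ⟨
  ∑ (allFin k) (λ p → ∑ (page p) (const 8))
    ≤⟨ ∑-mono (allFin k) (λ {p} _ → page-≥ p) ⟩
  ∑ (allFin k) (λ p → ∑ (page p) (λ e → 2 * mono e) + 13 * m)
    ≡⟨ ∑-+ (allFin k) _ _ ⟩
  ∑ (allFin k) (λ p → ∑ (page p) (λ e → 2 * mono e)) + ∑ (allFin k) (const (13 * m))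
    ≡⟨ cong₂ _+_ (∑-fibres χ (diagonals n) (λ e → 2 * mono e)) (trans (∑-const (allFin k) (13 * m)) (cong (_* (13 * m)) (length-tabulate {n = k} id))) ⟩
  ∑ (diagonals n) (λ e → 2 * mono e) + k * (13 * m)
    ≤⟨ +-monoˡ-≤ _ (∑-filter-≤ long? (edges n) _) ⟩
  ∑ (edges n) (λ e → 2 * mono e) + k * (13 * m)
    ≡⟨ cong (_+ k * (13 * m)) (∑-* (edges n) 2 mono) ⟩
  2 * ∑ (edges n) mono + k * (13 * m)
    ≡⟨ cong (λ c → 2 * c + k * (13 * m)) (crossings≡∑ χ) ⟨
  2 * crossings χ + k * (13 * m) ∎
  where
  open ≤-Reasoning
  n = 2 + m

  page : Fin k → List (Edge n)
  page p = filter (λ e → χ e Fin.≟ p) (diagonals n)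

  mono : Edge n → ℕ
  mono e = ∑ (edges n) (λ f → 𝟙 (monochromaticCrossing? χ (e , f)))

  page-≥ : ∀ p → ∑ (page p) (const 8) ≤ ∑ (page p) (λ e → 2 * mono e) + 13 * m
  page-≥ p = begin
    ∑ (page p) (const 8)
      ≡⟨ trans (∑-const (page p) 8) (*-comm (length (page p)) 8) ⟩
    8 * length (page p)
      ≡⟨ cong (8 *_) (length-map chord (page p)) ⟨
    8 * length (map chord (page p))
      ≤⟨ convex-crossings m _ (map chord (page p)) ≤-refl unique within ⟩
    2 * cr (map chord (page p)) (map chord (page p)) + 13 * m
      ≡⟨ cong (λ c → 2 * c + 13 * m) (trans (∑-map chord (page p) _)
           (∑-cong (page p) λ e → ∑-map chord (page p) (cross (chord e)))) ⟩
    2 * ∑ (page p) (λ e → ∑ (page p) (λ f → cross (chord e) (chord f))) + 13 * m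
      ≤⟨ +-monoˡ-≤ _ (*-monoʳ-≤ 2 (∑-mono (page p) λ {e} e∈ → begin
           ∑ (page p) (λ f → cross (chord e) (chord f))
             ≤⟨ ∑-mono (page p) (λ {f} f∈ → 𝟙-mono (crossing? _ _ _ _) (monochromaticCrossing? χ (e , f))
                  λ e×f → e×f , trans (colour e∈) (sym (colour f∈))) ⟩
           ∑ (page p) (λ f → 𝟙 (monochromaticCrossing? χ (e , f)))
             ≤⟨ ∑-filter-≤ (λ e → χ e Fin.≟ p) (diagonals n) _ ⟩
           ∑ (diagonals n) (λ f → 𝟙 (monochromaticCrossing? χ (e , f)))
             ≤⟨ ∑-filter-≤ long? (edges n) _ ⟩
           mono e ∎)) ⟩
    2 * ∑ (page p) mono + 13 * m
      ≡⟨ cong (_+ 13 * m) (∑-* (page p) 2 mono) ⟨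
    ∑ (page p) (λ e → 2 * mono e) + 13 * m ∎
    where
    colour : ∀ {e} → e ∈ page p → χ e ≡ p
    colour = proj₂ ∘ ∈-filter⁻ (λ e → χ e Fin.≟ p) {xs = diagonals n}

    unique : Unique (map chord (page p))
    unique = Unique.map⁺ chord-injective
      (Unique.filter⁺ (λ e → χ e Fin.≟ p) (Unique.filter⁺ long? (edges-unique n)))

    within : ∀ {c} → c ∈ map chord (page p) → 2 + proj₁ c ≤ proj₂ c × proj₂ c ≤ suc m
    within c∈ with e , e∈ , refl ← ∈-map⁻ chord c∈ =
      proj₂ (∈-filter⁻ long? {xs = edges n} (proj₁ (∈-filter⁻ (λ e → χ e Fin.≟ p) e∈))) , toℕ≤pred[n] (hi e)

-- Averaging over deleted vertices

data Repeats {A : Set} : ∀ {k} → Vec A k → Set where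
  here  : ∀ {k x} {xs : Vec A k} → x Vec.∈ xs → Repeats (x ∷ xs)
  there : ∀ {k x} {xs : Vec A k} → Repeats xs → Repeats (x ∷ xs)

-- marked sums over the tuples with a distinguished coordinate equal to v.

total : ∀ {n} k → (Vec (Fin n) k → ℕ) → ℕ
total     zero    H = H []
total {n} (suc k) H = ∑ (allFin n) λ x → total k (H ∘ (x ∷_))

avoiding : ∀ {n} k → Fin (suc n) → (Vec (Fin (suc n)) k → ℕ) → ℕ
avoiding     zero    v H = H []
avoiding {n} (suc k) v H = ∑ (allFin n) λ x → avoiding k v (H ∘ (punchIn v x ∷_))

marked : ∀ {n} k → Fin n → (Vec (Fin n) k → ℕ) → ℕ
marked     zero    v H = 0
marked {n} (suc k) v H = total k (H ∘ (v ∷_)) + ∑ (allFin n) λ x → marked k v (H ∘ (x ∷_))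

∑-zero : ∀ {n} (f : Fin n → ℕ) → (∀ x → f x ≡ 0) → ∑ (allFin n) f ≡ 0
∑-zero {n} f f≡0 = trans (∑-cong (allFin n) f≡0) (trans (∑-const (allFin n) 0) (*-zeroʳ (length (allFin n))))

total-zero : ∀ {n} k (H : Vec (Fin n) k → ℕ) → (∀ xs → H xs ≡ 0) → total k H ≡ 0
total-zero zero    H H≡0 = H≡0 []
total-zero (suc k) H H≡0 = ∑-zero _ λ x → total-zero k _ (H≡0 ∘ (x ∷_))

marked-zero : ∀ {n} k v (H : Vec (Fin n) k → ℕ) → (∀ xs → v Vec.∈ xs → H xs ≡ 0) → marked k v H ≡ 0
marked-zero zero    v H H≡0 = refl
marked-zero (suc k) v H H≡0 = cong₂ _+_
  (total-zero k _ λ xs → H≡0 (v ∷ xs) (here refl))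
  (∑-zero _ λ x → marked-zero k v _ λ xs → H≡0 (x ∷ xs) ∘ there)

-- A tuple on which `H` does not vanish has no repetition, so it either avoids `v` or meets it in
-- exactly one coordinate.
total≡avoiding+marked : ∀ {n} k v (H : Vec (Fin (suc n)) k → ℕ) → (∀ xs → Repeats xs → H xs ≡ 0) →
                        total k H ≡ avoiding k v H + marked k v H
total≡avoiding+marked         zero    v H H≡0 = sym (+-identityʳ (H []))
total≡avoiding+marked {n} (suc k) v H H≡0 = begin
  ∑ (allFin (suc n)) (λ x → total k (H ∘ (x ∷_)))
    ≡⟨ ∑-remove v (λ x → total k (H ∘ (x ∷_))) ⟩
  total k (H ∘ (v ∷_)) + ∑ (allFin n) (λ x → total k (H ∘ (punchIn v x ∷_)))
    ≡⟨ cong (total k (H ∘ (v ∷_)) +_) (∑-cong (allFin n) λ x →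
         total≡avoiding+marked k v (H ∘ (punchIn v x ∷_)) (λ xs → H≡0 (punchIn v x ∷ xs) ∘ there)) ⟩
  total k (H ∘ (v ∷_)) + ∑ (allFin n) (λ x → avoiding k v (H ∘ (punchIn v x ∷_)) + marked k v (H ∘ (punchIn v x ∷_)))
    ≡⟨ cong (total k (H ∘ (v ∷_)) +_) (∑-+ (allFin n) _ _) ⟩
  total k (H ∘ (v ∷_)) + (avoiding (suc k) v H + rest)
    ≡⟨ x∙yz≈y∙xz (total k (H ∘ (v ∷_))) (avoiding (suc k) v H) rest ⟩
  avoiding (suc k) v H + (total k (H ∘ (v ∷_)) + rest)
    ≡⟨ cong (λ m → avoiding (suc k) v H + (total k (H ∘ (v ∷_)) + (m + rest)))
         (marked-zero k v (H ∘ (v ∷_)) λ xs → H≡0 (v ∷ xs) ∘ here) ⟨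
  avoiding (suc k) v H + (total k (H ∘ (v ∷_)) + (marked k v (H ∘ (v ∷_)) + rest))
    ≡⟨ cong (λ m → avoiding (suc k) v H + (total k (H ∘ (v ∷_)) + m)) (∑-remove v (λ x → marked k v (H ∘ (x ∷_)))) ⟨
  avoiding (suc k) v H + marked (suc k) v H ∎
  where
  open ≡-Reasoning
  rest = ∑ (allFin n) (λ x → marked k v (H ∘ (punchIn v x ∷_)))

∑-marked : ∀ {n} k (H : Vec (Fin n) k → ℕ) → ∑ (allFin n) (λ v → marked k v H) ≡ k * total k H
∑-marked {n} zero    H = ∑-zero {n} _ λ _ → refl
∑-marked {n} (suc k) H = begin
  ∑ (allFin n) (λ v → marked (suc k) v H)
    ≡⟨ ∑-+ (allFin n) _ _ ⟩
  total (suc k) H + ∑ (allFin n) (λ v → ∑ (allFin n) λ x → marked k v (H ∘ (x ∷_)))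
    ≡⟨ cong (total (suc k) H +_) (∑-swap (allFin n) (allFin n) _) ⟩
  total (suc k) H + ∑ (allFin n) (λ x → ∑ (allFin n) λ v → marked k v (H ∘ (x ∷_)))
    ≡⟨ cong (total (suc k) H +_) (∑-cong (allFin n) λ x → ∑-marked k (H ∘ (x ∷_))) ⟩
  total (suc k) H + ∑ (allFin n) (λ x → k * total k (H ∘ (x ∷_)))
    ≡⟨ cong (total (suc k) H +_) (∑-* (allFin n) k _) ⟩
  suc k * total (suc k) H ∎
  where open ≡-Reasoning

-- Double counting: a tuple without repetition is destroyed by the deletion of exactly `k` of the
-- vertices. The additive form avoids subtraction.
∑-avoiding : ∀ {n} k (H : Vec (Fin (suc n)) k → ℕ) → (∀ xs → Repeats xs → H xs ≡ 0) →
             ∑ (allFin (suc n)) (λ v → avoiding k v H) + k * total k H ≡ suc n * total k H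
∑-avoiding {n} k H H≡0 = begin
  ∑ (allFin (suc n)) (λ v → avoiding k v H) + k * total k H
    ≡⟨ cong (∑ (allFin (suc n)) (λ v → avoiding k v H) +_) (∑-marked k H) ⟨
  ∑ (allFin (suc n)) (λ v → avoiding k v H) + ∑ (allFin (suc n)) (λ v → marked k v H)
    ≡⟨ ∑-+ (allFin (suc n)) (λ v → avoiding k v H) (λ v → marked k v H) ⟨
  ∑ (allFin (suc n)) (λ v → avoiding k v H + marked k v H)
    ≡⟨ ∑-cong (allFin (suc n)) (λ v → total≡avoiding+marked k v H H≡0) ⟨
  ∑ (allFin (suc n)) (const (total k H))
    ≡⟨ ∑-const (allFin (suc n)) (total k H) ⟩
  length (allFin (suc n)) * total k H
    ≡⟨ cong (_* total k H) (length-tabulate {n = suc n} id) ⟩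
  suc n * total k H ∎
  where open ≡-Reasoning

-- Crossings as 0/1 weights on 4-tuples of vertices, in the order `lo e`, `hi e`, `lo f`, `hi f`, so
-- that the count of tuples above applies to them.
ends : ∀ {k n} → Colouring k n → Vec (Fin n) 4 → ℕ
ends χ (a ∷ b ∷ c ∷ d ∷ []) =
  maybe′ (λ e → maybe′ (λ f → 𝟙 (monochromaticCrossing? χ (e , f))) 0 (toEdge (c , d))) 0 (toEdge (a , b))

crossings≡total : ∀ {k n} (χ : Colouring k n) → crossings χ ≡ total 4 (ends χ)
crossings≡total {n = n} χ = begin
  crossings χ
    ≡⟨ crossings≡∑ χ ⟩
  ∑ (edges n) (λ e → ∑ (edges n) (λ f → 𝟙 (monochromaticCrossing? χ (e , f))))
    ≡⟨ ∑-edges n _ ⟩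
  ∑ (allFin n) (λ a → ∑ (allFin n) λ b →
    maybe′ (λ e → ∑ (edges n) (λ f → 𝟙 (monochromaticCrossing? χ (e , f)))) 0 (toEdge (a , b)))
    ≡⟨ ∑-cong (allFin n) (λ a → ∑-cong (allFin n) (inner a)) ⟩
  total 4 (ends χ) ∎
  where
  open ≡-Reasoning
  inner : ∀ a b → maybe′ (λ e → ∑ (edges n) (λ f → 𝟙 (monochromaticCrossing? χ (e , f)))) 0 (toEdge (a , b))
                ≡ ∑ (allFin n) (λ c → ∑ (allFin n) λ d → ends χ (a ∷ b ∷ c ∷ d ∷ []))
  inner a b with toEdge (a , b)
  ... | just e  = ∑-edges n _
  ... | nothing = sym (∑-zero {n} _ λ _ → ∑-zero {n} _ λ _ → refl)

ends-repeats : ∀ {k n} (χ : Colouring k n) xs → Repeats xs → ends χ xs ≡ 0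
ends-repeats χ (a ∷ b ∷ c ∷ d ∷ []) rep with a Fin.<? b | c Fin.<? d
... | no _    | _       = refl
... | yes _   | no _    = refl
... | yes a<b | yes c<d = 𝟙-no (monochromaticCrossing? χ (edge a b a<b , edge c d c<d))
                              λ ((a<c , c<b , b<d) , _) → impossible a<c c<b b<d rep
  where
  impossible : a Fin.< c → c Fin.< b → b Fin.< d → ¬ Repeats (a ∷ b ∷ c ∷ d ∷ [])
  impossible a<c c<b b<d (here (here refl))                 = <-irrefl refl a<b
  impossible a<c c<b b<d (here (there (here refl)))         = <-irrefl refl a<c
  impossible a<c c<b b<d (here (there (there (here refl)))) = <-irrefl refl (<-trans a<b b<d)
  impossible a<c c<b b<d (there (here (here refl)))         = <-irrefl refl c<b
  impossible a<c c<b b<d (there (here (there (here refl)))) = <-irrefl refl b<d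
  impossible a<c c<b b<d (there (there (here (here refl)))) = <-irrefl refl c<d
  impossible a<c c<b b<d (there (there (there (here ()))))
  impossible a<c c<b b<d (there (there (there (there ()))))

punchIn-mono-< : ∀ {n} (v : Fin (suc n)) {i j : Fin n} → i Fin.< j → punchIn v i Fin.< punchIn v j
punchIn-mono-< v {i} {j} i<j = ≤∧≢⇒< (punchIn-mono-≤ v i j (<⇒≤ i<j))
  λ eq → <-irrefl (cong toℕ (punchIn-injective v i j (Fin.toℕ-injective eq))) i<j

deleteVertex : ∀ {k n} → Fin (suc n) → Colouring k (suc n) → Colouring k n
deleteVertex v χ (edge i j i<j) = χ (edge (punchIn v i) (punchIn v j) (punchIn-mono-< v i<j))

ends-delete : ∀ {k n} v (χ : Colouring k (suc n)) a b c d →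
  ends (deleteVertex v χ) (a ∷ b ∷ c ∷ d ∷ []) ≤
  ends χ (punchIn v a ∷ punchIn v b ∷ punchIn v c ∷ punchIn v d ∷ [])
ends-delete v χ a b c d with a Fin.<? b | c Fin.<? d
... | no _    | _       = z≤n
... | yes _   | no _    = z≤n
... | yes a<b | yes c<d with punchIn v a Fin.<? punchIn v b | punchIn v c Fin.<? punchIn v d
...   | no a≮b′  | _        = contradiction (punchIn-mono-< v a<b) a≮b′
...   | yes _    | no c≮d′  = contradiction (punchIn-mono-< v c<d) c≮d′
...   | yes a<b′ | yes c<d′ =
  𝟙-mono (monochromaticCrossing? (deleteVertex v χ) (edge a b a<b , edge c d c<d))
         (monochromaticCrossing? χ (edge _ _ a<b′ , edge _ _ c<d′))
         λ ((a<c , c<b , b<d) , eq) → (punchIn-mono-< v a<c , punchIn-mono-< v c<b , punchIn-mono-< v b<d) , eq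

crossings-delete : ∀ {k n} v (χ : Colouring k (suc n)) → crossings (deleteVertex v χ) ≤ avoiding 4 v (ends χ)
crossings-delete {n = n} v χ = ≤-trans (≤-reflexive (crossings≡total (deleteVertex v χ)))
  (∑-mono (allFin n) λ {a} _ → ∑-mono (allFin n) λ {b} _ → ∑-mono (allFin n) λ {c} _ → ∑-mono (allFin n) λ {d} _ →
    ends-delete v χ a b c d)

-- Without subtraction, this is (n + 1) L ≤ (n - 3) B c for c crossings: each crossing survives all
-- but four of the n + 1 deletions. The factor `B` keeps the rational bound L / B in the natural
-- numbers.
crossings-average : ∀ {k n} L B → (∀ (ψ : Colouring k n) → L ≤ B * crossings ψ) →
  (χ : Colouring k (suc n)) → suc n * L + 4 * (B * crossings χ) ≤ suc n * (B * crossings χ)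
crossings-average {k} {n} L B L≤ χ = begin
  suc n * L + 4 * (B * T)
    ≡⟨ cong₂ _+_ (trans (∑-const (allFin (suc n)) L) (cong (_* L) (length-tabulate {n = suc n} id))) refl ⟨
  ∑ (allFin (suc n)) (const L) + 4 * (B * T)
    ≤⟨ +-monoˡ-≤ _ (∑-mono (allFin (suc n)) λ {v} _ → ≤-trans (L≤ (deleteVertex v χ)) (*-monoʳ-≤ B (crossings-delete v χ))) ⟩
  ∑ (allFin (suc n)) (λ v → B * avoiding 4 v (ends χ)) + 4 * (B * T)
    ≡⟨ cong (_+ 4 * (B * T)) (∑-* (allFin (suc n)) B _) ⟩
  B * D + 4 * (B * T)
    ≡⟨ shuffle₁ B D T ⟩
  B * (D + 4 * T)
    ≡⟨ cong (λ t → B * (D + 4 * t)) (crossings≡total χ) ⟩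
  B * (D + 4 * total 4 (ends χ))
    ≡⟨ cong (B *_) (∑-avoiding 4 (ends χ) (ends-repeats χ)) ⟩
  B * (suc n * total 4 (ends χ))
    ≡⟨ cong (λ t → B * (suc n * t)) (crossings≡total χ) ⟨
  B * (suc n * T)
    ≡⟨ shuffle₂ B (suc n) T ⟩
  suc n * (B * T) ∎
  where
  open ≤-Reasoning
  T = crossings χ
  D = ∑ (allFin (suc n)) (λ v → avoiding 4 v (ends χ))
  shuffle₁ : ∀ B D T → B * D + 4 * (B * T) ≡ B * (D + 4 * T)
  shuffle₁ = solve-∀
  shuffle₂ : ∀ B n T → B * (n * T) ≡ n * (B * T)
  shuffle₂ = solve-∀

-- Binomial coefficients and the averaged bound

absorption : ∀ n k → suc k * (suc n C suc k) ≡ suc n * (n C k)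
absorption n zero = begin
  1 * (suc n C 1)  ≡⟨ *-identityˡ _ ⟩
  suc n C 1        ≡⟨ nC1≡n (suc n) ⟩
  suc n            ≡⟨ *-identityʳ (suc n) ⟨
  suc n * 1        ∎
  where open ≡-Reasoning
absorption zero (suc k) = *-zeroʳ (2 + k)
absorption (suc n) (suc k) = begin
  (2 + k) * ((2 + n) C (2 + k))
    ≡⟨ cong ((2 + k) *_) (nCk+nC[k+1]≡[n+1]C[k+1] (suc n) (suc k)) ⟨
  (2 + k) * (p + q)
    ≡⟨ shuffle₁ k p q ⟩
  p + (suc k * p + (2 + k) * q)
    ≡⟨ cong (p +_) (cong₂ _+_ (absorption n k) (absorption n (suc k))) ⟩
  p + (suc n * (n C k) + suc n * (n C suc k))
    ≡⟨ cong (p +_) (*-distribˡ-+ (suc n) (n C k) (n C suc k)) ⟨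
  p + suc n * (n C k + n C suc k)
    ≡⟨ cong (λ c → p + suc n * c) (nCk+nC[k+1]≡[n+1]C[k+1] n k) ⟩
  (2 + n) * p ∎
  where
  open ≡-Reasoning
  p = suc n C suc k
  q = suc n C (2 + k)
  shuffle₁ : ∀ k p q → (2 + k) * (p + q) ≡ p + (suc k * p + (2 + k) * q)
  shuffle₁ = solve-∀

24*nC4 : ∀ s → 24 * ((4 + s) C 4) ≡ (4 + s) * ((3 + s) * ((2 + s) * (1 + s)))
24*nC4 s = begin
  24 * ((4 + s) C 4)
    ≡⟨ *-assoc 6 4 ((4 + s) C 4) ⟩
  6 * (4 * ((4 + s) C 4))
    ≡⟨ cong (6 *_) (absorption (3 + s) 3) ⟩
  6 * ((4 + s) * ((3 + s) C 3))
    ≡⟨ shuffle (4 + s) ((3 + s) C 3) ⟩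
  (4 + s) * (2 * (3 * ((3 + s) C 3)))
    ≡⟨ cong (λ c → (4 + s) * (2 * c)) (absorption (2 + s) 2) ⟩
  (4 + s) * (2 * ((3 + s) * ((2 + s) C 2)))
    ≡⟨ cong ((4 + s) *_) (x*yz≈y*xz 2 (3 + s) ((2 + s) C 2)) ⟩
  (4 + s) * ((3 + s) * (2 * ((2 + s) C 2)))
    ≡⟨ cong (λ c → (4 + s) * ((3 + s) * c)) (absorption (1 + s) 1) ⟩
  (4 + s) * ((3 + s) * ((2 + s) * ((1 + s) C 1)))
    ≡⟨ cong (λ c → (4 + s) * ((3 + s) * ((2 + s) * c))) (nC1≡n (1 + s)) ⟩
  (4 + s) * ((3 + s) * ((2 + s) * (1 + s))) ∎
  where
  open ≡-Reasoning
  shuffle : ∀ a c → 6 * (a * c) ≡ a * (2 * (3 * c))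
  shuffle = solve-∀

-- With n = 4 + s, the factor (n + 1)/(n - 3) gained by averaging is exactly the quotient of
-- consecutive binomials, so the bound on the proportion is preserved.
nC4-suc : ∀ s → (5 + s) * ((4 + s) C 4) ≡ suc s * ((5 + s) C 4)
nC4-suc s = *-cancelˡ-≡ _ _ 24 (begin
  24 * ((5 + s) * ((4 + s) C 4))
    ≡⟨ x*yz≈y*xz 24 (5 + s) ((4 + s) C 4) ⟩
  (5 + s) * (24 * ((4 + s) C 4))
    ≡⟨ cong ((5 + s) *_) (24*nC4 s) ⟩
  (5 + s) * ((4 + s) * ((3 + s) * ((2 + s) * (1 + s))))
    ≡⟨ shuffle (5 + s) (4 + s) (3 + s) (2 + s) (1 + s) ⟩
  suc s * ((5 + s) * ((4 + s) * ((3 + s) * (2 + s))))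
    ≡⟨ cong (suc s *_) (24*nC4 (suc s)) ⟨
  suc s * (24 * ((5 + s) C 4))
    ≡⟨ x*yz≈y*xz (suc s) 24 ((5 + s) C 4) ⟩
  24 * (suc s * ((5 + s) C 4)) ∎)
  where
  open ≡-Reasoning
  shuffle : ∀ a b c d e → a * (b * (c * (d * e))) ≡ e * (a * (b * (c * d)))
  shuffle = solve-∀

-- For k = 1 + κ pages the base case of the averaging is n = 5k, where summing
-- the page bounds gives at least (5k − 2)(7k − 4) / 2 crossings.
excess : ℕ → ℕ
excess κ = (3 + 5 * κ) * (3 + 7 * κ)

excess-≤ : ∀ κ (χ : Colouring (suc κ) (5 + 5 * κ)) → excess κ ≤ 2 * crossings χ
excess-≤ κ χ = +-cancelʳ-≤ (suc κ * (13 * m)) _ _ (begin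
  excess κ + suc κ * (13 * m)          ≡⟨ shuffle κ ⟩
  4 * (m * suc m)                      ≤⟨ crossings-≥ m χ ⟩
  2 * crossings χ + suc κ * (13 * m)   ∎)
  where
  open ≤-Reasoning
  m = 3 + 5 * κ
  shuffle : ∀ κ → (3 + 5 * κ) * (3 + 7 * κ) + suc κ * (13 * (3 + 5 * κ)) ≡ 4 * ((3 + 5 * κ) * suc (3 + 5 * κ))
  shuffle = solve-∀

excess-average : ∀ κ t (χ : Colouring (suc κ) (t + (5 + 5 * κ))) →
  excess κ * ((t + (5 + 5 * κ)) C 4) ≤ 2 * ((5 + 5 * κ) C 4) * crossings χ
excess-average κ zero χ = begin
  excess κ * ((5 + 5 * κ) C 4)              ≤⟨ *-monoˡ-≤ ((5 + 5 * κ) C 4) (excess-≤ κ χ) ⟩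
  2 * crossings χ * ((5 + 5 * κ) C 4)       ≡⟨ shuffle (crossings χ) _ ⟩
  2 * ((5 + 5 * κ) C 4) * crossings χ       ∎
  where
  open ≤-Reasoning
  shuffle : ∀ c b → 2 * c * b ≡ 2 * b * c
  shuffle = solve-∀
excess-average κ (suc t) χ = *-cancelˡ-≤ (suc s) (+-cancelʳ-≤ (4 * T) _ _ (begin
  suc s * (excess κ * (suc n C 4)) + 4 * T
    ≡⟨ cong (_+ 4 * T) key ⟩
  suc n * (excess κ * (n C 4)) + 4 * T
    ≤⟨ crossings-average (excess κ * (n C 4)) (2 * ((5 + 5 * κ) C 4)) (excess-average κ t) χ ⟩
  suc n * T
    ≡⟨ cong (λ n → suc n * T) n≡ ⟩
  (5 + s) * T
    ≡⟨ shuffle₂ s T ⟩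
  suc s * T + 4 * T ∎))
  where
  open ≤-Reasoning
  n = t + (5 + 5 * κ)
  s = t + (1 + 5 * κ)
  T = 2 * ((5 + 5 * κ) C 4) * crossings χ
  n≡ : n ≡ 4 + s
  n≡ = shuffle₁ t (5 * κ)
    where
    shuffle₁ : ∀ t x → t + (5 + x) ≡ 4 + (t + (1 + x))
    shuffle₁ = solve-∀
  shuffle₂ : ∀ s T → (5 + s) * T ≡ suc s * T + 4 * T
  shuffle₂ = solve-∀
  shuffle₃ : ∀ s x c → s * (x * c) ≡ x * (s * c)
  shuffle₃ = solve-∀
  key : suc s * (excess κ * (suc n C 4)) ≡ suc n * (excess κ * (n C 4))
  key = begin-equality
    suc s * (excess κ * (suc n C 4))      ≡⟨ cong (λ n → suc s * (excess κ * (suc n C 4))) n≡ ⟩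
    suc s * (excess κ * ((5 + s) C 4))    ≡⟨ shuffle₃ (suc s) (excess κ) ((5 + s) C 4) ⟩
    excess κ * (suc s * ((5 + s) C 4))    ≡⟨ cong (excess κ *_) (nC4-suc s) ⟨
    excess κ * ((5 + s) * ((4 + s) C 4))  ≡⟨ shuffle₃ (excess κ) (5 + s) ((4 + s) C 4) ⟩
    (5 + s) * (excess κ * ((4 + s) C 4))  ≡⟨ cong (λ n → suc n * (excess κ * (n C 4))) n≡ ⟨
    suc n * (excess κ * (n C 4))          ∎

-- The constants

open import Data.Integer using (+_)

Poly : Set
Poly = List ℕ

infixl 6 _⊕_
infixl 7 _⊗_

_⊕_ : Poly → Poly → Poly
[]      ⊕ q       = q
(c ∷ p) ⊕ []      = c ∷ p
(c ∷ p) ⊕ (d ∷ q) = (c + d) ∷ (p ⊕ q)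

_⊗_ : Poly → Poly → Poly
[]      ⊗ q = []
(c ∷ p) ⊗ q = map (c *_) q ⊕ (0 ∷ p ⊗ q)

-- The coefficients are large numerals: evaluation is kept abstract so that they
-- are never unfolded to successors when polynomials in t are compared.
abstract

  ⟦_⟧ : Poly → ℕ → ℕ
  ⟦ [] ⟧    t = 0
  ⟦ c ∷ p ⟧ t = c + t * ⟦ p ⟧ t

  ⟦⊕⟧ : ∀ p q t → ⟦ p ⊕ q ⟧ t ≡ ⟦ p ⟧ t + ⟦ q ⟧ t
  ⟦⊕⟧ []      q       t = refl
  ⟦⊕⟧ (c ∷ p) []      t = sym (+-identityʳ _)
  ⟦⊕⟧ (c ∷ p) (d ∷ q) t = trans (cong (λ x → c + d + t * x) (⟦⊕⟧ p q t)) (shuffle c d t (⟦ p ⟧ t) (⟦ q ⟧ t))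
    where
    shuffle : ∀ c d t x y → c + d + t * (x + y) ≡ c + t * x + (d + t * y)
    shuffle = solve-∀

  ⟦map⟧ : ∀ c q t → ⟦ map (c *_) q ⟧ t ≡ c * ⟦ q ⟧ t
  ⟦map⟧ c []      t = sym (*-zeroʳ c)
  ⟦map⟧ c (d ∷ q) t = trans (cong (λ x → c * d + t * x) (⟦map⟧ c q t)) (shuffle c d t (⟦ q ⟧ t))
    where
    shuffle : ∀ c d t x → c * d + t * (c * x) ≡ c * (d + t * x)
    shuffle = solve-∀

  ⟦⊗⟧ : ∀ p q t → ⟦ p ⊗ q ⟧ t ≡ ⟦ p ⟧ t * ⟦ q ⟧ t
  ⟦⊗⟧ []      q t = refl
  ⟦⊗⟧ (c ∷ p) q t = begin
    ⟦ map (c *_) q ⊕ (0 ∷ p ⊗ q) ⟧ t        ≡⟨ ⟦⊕⟧ (map (c *_) q) (0 ∷ p ⊗ q) t ⟩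
    ⟦ map (c *_) q ⟧ t + t * ⟦ p ⊗ q ⟧ t    ≡⟨ cong₂ (λ x y → x + t * y) (⟦map⟧ c q t) (⟦⊗⟧ p q t) ⟩
    c * ⟦ q ⟧ t + t * (⟦ p ⟧ t * ⟦ q ⟧ t)        ≡⟨ shuffle c t (⟦ p ⟧ t) (⟦ q ⟧ t) ⟩
    (c + t * ⟦ p ⟧ t) * ⟦ q ⟧ t                  ∎
    where
    open ≡-Reasoning
    shuffle : ∀ c t x y → c * y + t * (x * y) ≡ (c + t * x) * y
    shuffle = solve-∀

  ⟦⟧-mono : ∀ {p q} t → Pointwise _≤_ p q → ⟦ p ⟧ t ≤ ⟦ q ⟧ t
  ⟦⟧-mono t []            = z≤n
  ⟦⟧-mono t (c≤d ∷ p≤q) = +-mono-≤ c≤d (*-monoʳ-≤ t (⟦⟧-mono t p≤q))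

  lin : ∀ a b t → a + b * t ≡ ⟦ a ∷ b ∷ [] ⟧ t
  lin a b t = shuffle a b t
    where
    shuffle : ∀ a b t → a + b * t ≡ a + t * (b + t * 0)
    shuffle = solve-∀

  quad : ∀ a b c t → a + b * t + c * (t * t) ≡ ⟦ a ∷ b ∷ c ∷ [] ⟧ t
  quad a b c t = shuffle a b c t
    where
    shuffle : ∀ a b c t → a + b * t + c * (t * t) ≡ a + t * (b + t * (c + t * 0))
    shuffle = solve-∀

  const⟦⟧ : ∀ c t → c ≡ ⟦ c ∷ [] ⟧ t
  const⟦⟧ c t = sym (trans (cong (λ x → c + x) (*-zeroʳ t)) (+-identityʳ c))

-- As `t` is a natural number, comparing coefficients suffices. The comparison is evaluated in the
-- implicit argument and requires lists of equal length.
⟦⟧-≤ : ∀ p q t → {True (decidable _≤?_ p q)} → ⟦ p ⟧ t ≤ ⟦ q ⟧ t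
⟦⟧-≤ p q t {p≤q} = ⟦⟧-mono t (toWitness p≤q)

-- Here k = 3 + t, and baseᴾ is 5k(5k − 1)(5k − 2)(5k − 3).

pagesᴾ denominatorᴾ numeratorᴾ excessᴾ baseᴾ : Poly
pagesᴾ       = 3 ∷ 1 ∷ []
denominatorᴾ = (37 ∷ []) ⊗ (316 ∷ 111 ∷ []) ⊗ (256 ∷ 111 ∷ []) ⊗ (92 ∷ 37 ∷ []) ⊗ (8 ∷ 3 ∷ [])
numeratorᴾ   = (8000 ∷ []) ⊗ (22024 ∷ 19226 ∷ 4107 ∷ [])
excessᴾ      = (13 ∷ 5 ∷ []) ⊗ (17 ∷ 7 ∷ [])
baseᴾ        = (15 ∷ 5 ∷ []) ⊗ ((14 ∷ 5 ∷ []) ⊗ ((13 ∷ 5 ∷ []) ⊗ (12 ∷ 5 ∷ [])))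

⊗-≡ : ∀ p q t {x y} → x ≡ ⟦ p ⟧ t → y ≡ ⟦ q ⟧ t → x * y ≡ ⟦ p ⊗ q ⟧ t
⊗-≡ p q t x≡ y≡ = trans (cong₂ _*_ x≡ y≡) (sym (⟦⊗⟧ p q t))

a*k∸b : ∀ a b c t → 3 * a ≡ b + c → a * (3 + t) ∸ b ≡ ⟦ c ∷ a ∷ [] ⟧ t
a*k∸b a b c t 3a≡b+c = begin
  a * (3 + t) ∸ b        ≡⟨ cong (_∸ b) (*-distribˡ-+ a 3 t) ⟩
  a * 3 + a * t ∸ b      ≡⟨ cong (λ x → x + a * t ∸ b) (trans (*-comm a 3) 3a≡b+c) ⟩
  b + c + a * t ∸ b      ≡⟨ cong (_∸ b) (+-assoc b c (a * t)) ⟩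
  b + (c + a * t) ∸ b    ≡⟨ m+n∸m≡n b (c + a * t) ⟩
  c + a * t              ≡⟨ lin c a t ⟩
  ⟦ c ∷ a ∷ [] ⟧ t       ∎
  where open ≡-Reasoning

shifted : ∀ a b t → a + b * (2 + t) ≡ ⟦ a + 2 * b ∷ b ∷ [] ⟧ t
shifted a b t = trans (shuffle a b t) (lin (a + 2 * b) b t)
  where
  shuffle : ∀ a b t → a + b * (2 + t) ≡ a + 2 * b + b * t
  shuffle = solve-∀

denominator≡ : ∀ t → denominator (3 + t) ≡ ⟦ denominatorᴾ ⟧ t
denominator≡ t =
  ⊗-≡ ((37 ∷ []) ⊗ (316 ∷ 111 ∷ []) ⊗ (256 ∷ 111 ∷ []) ⊗ (92 ∷ 37 ∷ [])) (8 ∷ 3 ∷ []) t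
    (⊗-≡ ((37 ∷ []) ⊗ (316 ∷ 111 ∷ []) ⊗ (256 ∷ 111 ∷ [])) (92 ∷ 37 ∷ []) t
      (⊗-≡ ((37 ∷ []) ⊗ (316 ∷ 111 ∷ [])) (256 ∷ 111 ∷ []) t
        (⊗-≡ (37 ∷ []) (316 ∷ 111 ∷ []) t (const⟦⟧ 37 t) (a*k∸b 111 17 316 t refl))
        (a*k∸b 111 77 256 t refl))
      (a*k∸b 37 19 92 t refl))
    (a*k∸b 3 1 8 t refl)

excess≡ : ∀ t → excess (2 + t) ≡ ⟦ excessᴾ ⟧ t
excess≡ t = ⊗-≡ (13 ∷ 5 ∷ []) (17 ∷ 7 ∷ []) t (shifted 3 5 t) (shifted 3 7 t)

base≡ : ∀ t → 24 * ((5 + 5 * (2 + t)) C 4) ≡ ⟦ baseᴾ ⟧ t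
base≡ t = trans (24*nC4 (1 + 5 * (2 + t)))
  (⊗-≡ (15 ∷ 5 ∷ []) ((14 ∷ 5 ∷ []) ⊗ ((13 ∷ 5 ∷ []) ⊗ (12 ∷ 5 ∷ []))) t (shifted 5 5 t) (⊗-≡ (14 ∷ 5 ∷ []) ((13 ∷ 5 ∷ []) ⊗ (12 ∷ 5 ∷ [])) t (shifted 4 5 t)
    (⊗-≡ (13 ∷ 5 ∷ []) (12 ∷ 5 ∷ []) t (shifted 3 5 t) (shifted 2 5 t))))

numerator : ℕ → ℕ
numerator t = ⟦ numeratorᴾ ⟧ t

-- Stated for arbitrary coefficients, since integer arithmetic on numerals and
-- + t would be evaluated in unary.
module _ (c d e : ℤ) (p q r : ℕ) where

  quadratic : c ℤ.* + 9 ℤ.- d ℤ.* + 3 ℤ.+ e ≡ + p → c ℤ.* + 6 ℤ.- d ≡ + q → c ≡ + r →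
              ∀ t → c ℤ.* + ((3 + t) ^ 2) ℤ.- d ℤ.* + (3 + t) ℤ.+ e ≡ + ⟦ p ∷ q ∷ r ∷ [] ⟧ t
  quadratic p≡ q≡ r≡ t = begin
    c ℤ.* + ((3 + t) ^ 2) ℤ.- d ℤ.* + (3 + t) ℤ.+ e
      ≡⟨ cong₂ (λ x y → c ℤ.* x ℤ.- d ℤ.* y ℤ.+ e)
           (trans (cong (λ n → + ((3 + t) * n)) (*-identityʳ (3 + t)))
                  (trans (ℤ.pos-* (3 + t) (3 + t)) (cong₂ ℤ._*_ (ℤ.pos-+ 3 t) (ℤ.pos-+ 3 t))))
           (ℤ.pos-+ 3 t) ⟩
    c ℤ.* ((+ 3 ℤ.+ + t) ℤ.* (+ 3 ℤ.+ + t)) ℤ.- d ℤ.* (+ 3 ℤ.+ + t) ℤ.+ e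
      ≡⟨ expand c d e (+ t) ⟩
    (c ℤ.* + 9 ℤ.- d ℤ.* + 3 ℤ.+ e) ℤ.+ (c ℤ.* + 6 ℤ.- d) ℤ.* + t ℤ.+ c ℤ.* (+ t ℤ.* + t)
      ≡⟨ cong₂ ℤ._+_ (cong₂ (λ x y → x ℤ.+ y ℤ.* + t) p≡ q≡) (cong (ℤ._* (+ t ℤ.* + t)) r≡) ⟩
    + p ℤ.+ + q ℤ.* + t ℤ.+ + r ℤ.* (+ t ℤ.* + t)
      ≡⟨ cong₂ (λ x y → + p ℤ.+ x ℤ.+ y) (ℤ.pos-* q t) (trans (ℤ.pos-* r (t * t)) (cong (+ r ℤ.*_) (ℤ.pos-* t t))) ⟨
    + p ℤ.+ + (q * t) ℤ.+ + (r * (t * t))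
      ≡⟨ trans (ℤ.pos-+ (p + q * t) (r * (t * t))) (cong (ℤ._+ + (r * (t * t))) (ℤ.pos-+ p (q * t))) ⟨
    + (p + q * t + r * (t * t))
      ≡⟨ cong (λ n → + n) (quad p q r t) ⟩
    + ⟦ p ∷ q ∷ r ∷ [] ⟧ t ∎
    where
    open ≡-Reasoning
    expand : ∀ c d e x → c ℤ.* ((+ 3 ℤ.+ x) ℤ.* (+ 3 ℤ.+ x)) ℤ.- d ℤ.* (+ 3 ℤ.+ x) ℤ.+ e
      ≡ (c ℤ.* + 9 ℤ.- d ℤ.* + 3 ℤ.+ e) ℤ.+ (c ℤ.* + 6 ℤ.- d) ℤ.* x ℤ.+ c ℤ.* (x ℤ.* x)
    expand = ℤSolver.solve-∀

scale : ∀ m p t {z} → z ≡ + ⟦ p ⟧ t → + m ℤ.* z ≡ + ⟦ (m ∷ []) ⊗ p ⟧ t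
scale m p t refl = trans (sym (ℤ.pos-* m (⟦ p ⟧ t)))
  (cong (λ n → + n) (⊗-≡ (m ∷ []) p t (const⟦⟧ m t) refl))

numerator≡ : ∀ t → + 8000 ℤ.* (+ 4107 ℤ.* + ((3 + t) ^ 2) ℤ.- + 5416 ℤ.* + (3 + t) ℤ.+ + 1309) ≡ + numerator t
numerator≡ t = scale 8000 (22024 ∷ 19226 ∷ 4107 ∷ []) t
  (quadratic (+ 4107) (+ 5416) (+ 1309) 22024 19226 4107 refl refl refl t)

-- Fractions and the lower bound

toℚᵘ-/ : ∀ a b .{{_ : NonZero b}} → ℚ.toℚᵘ (a ℚ./ b) ℚᵘ.≃ a ℚᵘ./ b
toℚᵘ-/ a (suc b) = ℚ.toℚᵘ-fromℚᵘ (mkℚᵘ a b)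

/-≤ : ∀ a b c d .{{b≢0 : NonZero b}} .{{d≢0 : NonZero d}} → a * d ≤ c * b → + a ℚ./ b ℚ.≤ + c ℚ./ d
/-≤ a b@(suc _) c d@(suc _) ad≤cb = ℚ.toℚᵘ-cancel-≤
  (ℚᵘ.≤-respˡ-≃ (ℚᵘ.≃-sym (toℚᵘ-/ (+ a) b)) (ℚᵘ.≤-respʳ-≃ (ℚᵘ.≃-sym (toℚᵘ-/ (+ c) d))
    (*≤* (subst₂ ℤ._≤_ (ℤ.pos-* a d) (ℤ.pos-* c b) (ℤ.+≤+ ad≤cb)))))

/-* : ∀ a b c d .{{b≢0 : NonZero b}} .{{d≢0 : NonZero d}} .{{bd≢0 : NonZero (b * d)}} →
      (+ a ℚ./ b) ℚ.* (+ c ℚ./ d) ≡ + (a * c) ℚ./ (b * d)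
/-* a b@(suc _) c d@(suc _) = ℚ.toℚᵘ-injective (begin
  ℚ.toℚᵘ ((+ a ℚ./ b) ℚ.* (+ c ℚ./ d))            ≈⟨ ℚ.toℚᵘ-homo-* (+ a ℚ./ b) (+ c ℚ./ d) ⟩
  ℚ.toℚᵘ (+ a ℚ./ b) ℚᵘ.* ℚ.toℚᵘ (+ c ℚ./ d)      ≈⟨ ℚᵘ.*-cong (toℚᵘ-/ (+ a) b) (toℚᵘ-/ (+ c) d) ⟩
  (+ a ℤ.* + c) ℚᵘ./ (b * d)                      ≡⟨ cong (ℚᵘ._/ (b * d)) (ℤ.pos-* a c) ⟨
  + (a * c) ℚᵘ./ (b * d)                          ≈⟨ toℚᵘ-/ (+ (a * c)) (b * d) ⟨
  ℚ.toℚᵘ (+ (a * c) ℚ./ (b * d))                  ∎)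
  where open ℚᵘ.≃-Reasoning

/-+ : ∀ a b c d .{{b≢0 : NonZero b}} .{{d≢0 : NonZero d}} .{{bd≢0 : NonZero (b * d)}} →
      (+ a ℚ./ b) ℚ.+ (+ c ℚ./ d) ≡ + (a * d + c * b) ℚ./ (b * d)
/-+ a b@(suc _) c d@(suc _) = ℚ.toℚᵘ-injective (begin
  ℚ.toℚᵘ ((+ a ℚ./ b) ℚ.+ (+ c ℚ./ d))            ≈⟨ ℚ.toℚᵘ-homo-+ (+ a ℚ./ b) (+ c ℚ./ d) ⟩
  ℚ.toℚᵘ (+ a ℚ./ b) ℚᵘ.+ ℚ.toℚᵘ (+ c ℚ./ d)      ≈⟨ ℚᵘ.+-cong (toℚᵘ-/ (+ a) b) (toℚᵘ-/ (+ c) d) ⟩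
  (+ a ℤ.* + d ℤ.+ + c ℤ.* + b) ℚᵘ./ (b * d)      ≡⟨ cong (ℚᵘ._/ (b * d)) numerators ⟨
  + (a * d + c * b) ℚᵘ./ (b * d)                  ≈⟨ toℚᵘ-/ (+ (a * d + c * b)) (b * d) ⟨
  ℚ.toℚᵘ (+ (a * d + c * b) ℚ./ (b * d))          ∎)
  where
  open ℚᵘ.≃-Reasoning
  numerators : + (a * d + c * b) ≡ + a ℤ.* + d ℤ.+ + c ℤ.* + b
  numerators = trans (ℤ.pos-+ (a * d) (c * b)) (cong₂ ℤ._+_ (ℤ.pos-* a d) (ℤ.pos-* c b))

coefficient≡ : ∀ t → coefficient (3 + t) ≡ (+ numerator t ℚ./ denominator (3 + t)) {{denominator≢0 (3 + t)}}
coefficient≡ t = cong (λ z → (z ℚ./ denominator (3 + t)) {{denominator≢0 (3 + t)}}) (numerator≡ t)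

⊕-≡ : ∀ p q t {x y} → x ≡ ⟦ p ⟧ t → y ≡ ⟦ q ⟧ t → x + y ≡ ⟦ p ⊕ q ⟧ t
⊕-≡ p q t x≡ y≡ = trans (cong₂ _+_ x≡ y≡) (sym (⟦⊕⟧ p q t))

-- The coefficient is at most the proportion reached at n = 5k; asymptotically 8000/12321 is
-- compared with 84/125. The factor 24 turns the binomial into a polynomial.
numerator-≤ : ∀ t → numerator t * (2 * ((5 + 5 * (2 + t)) C 4)) ≤ excess (2 + t) * denominator (3 + t)
numerator-≤ t = *-cancelˡ-≤ 24 (begin
  24 * (numerator t * (2 * c))                     ≡⟨ shuffle (numerator t) c ⟩
  numerator t * (2 * (24 * c))                     ≡⟨ ⊗-≡ numeratorᴾ ((2 ∷ []) ⊗ baseᴾ) t refl (⊗-≡ (2 ∷ []) baseᴾ t (const⟦⟧ 2 t) (base≡ t)) ⟩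
  ⟦ numeratorᴾ ⊗ ((2 ∷ []) ⊗ baseᴾ) ⟧ t            ≤⟨ ⟦⟧-≤ (numeratorᴾ ⊗ ((2 ∷ []) ⊗ baseᴾ)) ((24 ∷ []) ⊗ (excessᴾ ⊗ denominatorᴾ)) t ⟩
  ⟦ (24 ∷ []) ⊗ (excessᴾ ⊗ denominatorᴾ) ⟧ t       ≡⟨ ⊗-≡ (24 ∷ []) (excessᴾ ⊗ denominatorᴾ) t (const⟦⟧ 24 t)
                                                        (⊗-≡ excessᴾ denominatorᴾ t (excess≡ t) (denominator≡ t)) ⟨
  24 * (excess (2 + t) * denominator (3 + t))      ∎)
  where
  open ≤-Reasoning
  c = (5 + 5 * (2 + t)) C 4
  shuffle : ∀ n c → 24 * (n * (2 * c)) ≡ n * (2 * (24 * c))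
  shuffle = solve-∀

nC4≢0 : ∀ s → NonZero ((4 + s) C 4)
nC4≢0 s = ≢-nonZero λ c≡0 → contradiction′ (trans (sym (cong (24 *_) c≡0)) (24*nC4 s))
  where
  contradiction′ : ∀ {A : Set} → 0 ≡ (4 + s) * ((3 + s) * ((2 + s) * (1 + s))) → A
  contradiction′ ()

clear-denominators : ∀ {p d a b c n} .{{_ : NonZero b}} → p * b ≤ a * d → a * c ≤ b * n → p * c ≤ n * d
clear-denominators {p} {d} {a} {b} {c} {n} pb≤ad ac≤bn = *-cancelˡ-≤ b (begin
  b * (p * c)  ≡⟨ shuffle₁ b p c ⟩
  p * b * c    ≤⟨ *-monoˡ-≤ c pb≤ad ⟩
  a * d * c    ≡⟨ shuffle₂ a d c ⟩
  a * c * d    ≤⟨ *-monoˡ-≤ d ac≤bn ⟩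
  b * n * d    ≡⟨ *-assoc b n d ⟩
  b * (n * d)  ∎)
  where
  open ≤-Reasoning
  shuffle₁ : ∀ b p c → b * (p * c) ≡ p * b * c
  shuffle₁ = solve-∀
  shuffle₂ : ∀ a d c → a * d * c ≡ a * c * d
  shuffle₂ = solve-∀

fraction-≤ : ∀ P D c N .{{_ : NonZero D}} → P * c ≤ N * D → (+ P ℚ./ D) ℚ.* fromℕ c ℚ.≤ fromℕ N
fraction-≤ P D c N Pc≤ND = subst (ℚ._≤ fromℕ N) (sym (/-* P D c 1 {{bd≢0 = D*1≢0}}))
  (/-≤ (P * c) (D * 1) N 1 {{b≢0 = D*1≢0}}
    (≤-trans (≤-reflexive (*-identityʳ (P * c))) (≤-trans Pc≤ND (≤-reflexive (cong (N *_) (sym (*-identityʳ D)))))))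
  where
  D*1≢0 : NonZero (D * 1)
  D*1≢0 = m*n≢0 D 1

lower-bound : ∀ t n → 5 + 5 * (2 + t) ≤ n → coefficient (3 + t) ℚ.* fromℕ (n C 4) ℚ.≤ fromℕ (ν (3 + t) n)
lower-bound t n 5k≤n = subst (λ q → q ℚ.* fromℕ (n C 4) ℚ.≤ fromℕ (ν (3 + t) n)) (sym (coefficient≡ t))
  (fraction-≤ (numerator t) (denominator (3 + t)) (n C 4) (ν (3 + t) n) {{denominator≢0 (3 + t)}}
    (clear-denominators {numerator t} {denominator (3 + t)} {excess (2 + t)} {2 * ((5 + 5 * (2 + t)) C 4)}
      {n C 4} {ν (3 + t) n} {{m*n≢0 2 ((5 + 5 * (2 + t)) C 4) {{_}} {{nC4≢0 (1 + 5 * (2 + t))}}}}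
      (numerator-≤ t)
      -- `ν` unfolds to the crossings of this colouring, so the bound for all colourings specialises
      -- to it.
      (averaged n (m∸n+n≡m 5k≤n) (optimalColouring (3 + t) n))))
  where
  averaged : ∀ n → n ∸ (5 + 5 * (2 + t)) + (5 + 5 * (2 + t)) ≡ n → (χ : Colouring (3 + t) n) →
             excess (2 + t) * (n C 4) ≤ 2 * ((5 + 5 * (2 + t)) C 4) * crossings χ
  averaged n n≡ = subst (λ n → (χ : Colouring (3 + t) n) →
    excess (2 + t) * (n C 4) ≤ 2 * ((5 + 5 * (2 + t)) C 4) * crossings χ) n≡ (excess-average (2 + t) (n ∸ (5 + 5 * (2 + t))))

5k≤111k/20 : ∀ t → 5 + 5 * (2 + t) ≤ (111 * (3 + t)) / 20
5k≤111k/20 t = begin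
  5 + 5 * (2 + t)             ≡⟨ shuffle t ⟩
  5 * (3 + t)                 ≡⟨ m*n/n≡m (5 * (3 + t)) 20 ⟨
  5 * (3 + t) * 20 / 20       ≤⟨ /-monoˡ-≤ 20 (≤-trans (≤-reflexive (x*5*20 (3 + t))) (*-monoˡ-≤ (3 + t) (m≤m+n 100 11))) ⟩
  111 * (3 + t) / 20          ∎
  where
  open ≤-Reasoning
  shuffle : ∀ t → 5 + 5 * (2 + t) ≡ 5 * (3 + t)
  shuffle = solve-∀
  x*5*20 : ∀ x → 5 * x * 20 ≡ 100 * x
  x*5*20 = solve-∀

-- The error term of the coefficient

+-cancel : ∀ p r → (p ℚ.+ r) ℚ.- r ≡ p
+-cancel p r = trans (ℚ.+-assoc p r (ℚ.- r)) (trans (cong (p ℚ.+_) (ℚ.+-inverseʳ r)) (ℚ.+-identityʳ p))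

≤-minus : ∀ {p q r} → p ℚ.+ r ℚ.≤ q → p ℚ.≤ q ℚ.- r
≤-minus {p} {q} {r} h = subst (ℚ._≤ q ℚ.- r) (+-cancel p r) (ℚ.+-monoˡ-≤ (ℚ.- r) h)

minus-≤ : ∀ {p q r} → q ℚ.≤ p ℚ.+ r → q ℚ.- r ℚ.≤ p
minus-≤ {p} {q} {r} h = subst (q ℚ.- r ℚ.≤_) (+-cancel p r) (ℚ.+-monoˡ-≤ (ℚ.- r) h)

squareᴾ cubeᴾ : Poly
squareᴾ = pagesᴾ ⊗ (pagesᴾ ⊗ (1 ∷ []))
cubeᴾ   = pagesᴾ ⊗ squareᴾ

sumᴾ : (a b c d : ℕ) → Poly
sumᴾ a b c d = ((a * 1 ∷ []) ⊗ ((d ∷ []) ⊗ squareᴾ) ⊕ (c * 1 ∷ []) ⊗ ((b ∷ []) ⊗ cubeᴾ)) ⊗ denominatorᴾ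

productᴾ : (b d : ℕ) → Poly
productᴾ b d = numeratorᴾ ⊗ (((b ∷ []) ⊗ cubeᴾ) ⊗ ((d ∷ []) ⊗ squareᴾ))

module _ (a b c d K₃ K₂ P D : ℕ) .{{_ : NonZero b}} .{{_ : NonZero d}}
         .{{_ : NonZero K₃}} .{{_ : NonZero K₂}} .{{_ : NonZero D}} where

  private
    bK₃≢0 : NonZero (b * K₃)
    bK₃≢0 = m*n≢0 b K₃
    dK₂≢0 : NonZero (d * K₂)
    dK₂≢0 = m*n≢0 d K₂
    product≢0 : NonZero (b * K₃ * (d * K₂))
    product≢0 = m*n≢0 (b * K₃) (d * K₂) {{bK₃≢0}} {{dK₂≢0}}

    common : (+ a ℚ./ b) ℚ.* (+ 1 ℚ./ K₃) ℚ.+ (+ c ℚ./ d) ℚ.* (+ 1 ℚ./ K₂)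
           ≡ (+ (a * 1 * (d * K₂) + c * 1 * (b * K₃)) ℚ./ (b * K₃ * (d * K₂))) {{product≢0}}
    common = trans (cong₂ ℚ._+_ (/-* a b 1 K₃ {{bd≢0 = bK₃≢0}}) (/-* c d 1 K₂ {{bd≢0 = dK₂≢0}}))
                   (/-+ (a * 1) (b * K₃) (c * 1) (d * K₂) {{bK₃≢0}} {{dK₂≢0}} {{product≢0}})

    num den : ℕ
    num = a * 1 * (d * K₂) + c * 1 * (b * K₃)
    den = b * K₃ * (d * K₂)

  sum-≤-fraction : num * D ≤ P * den →
    (+ a ℚ./ b) ℚ.* (+ 1 ℚ./ K₃) ℚ.+ (+ c ℚ./ d) ℚ.* (+ 1 ℚ./ K₂) ℚ.≤ + P ℚ./ D
  sum-≤-fraction h = subst (ℚ._≤ + P ℚ./ D) (sym common) (/-≤ num den P D {{b≢0 = product≢0}} h)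

  fraction-≤-sum : P * den ≤ num * D →
    + P ℚ./ D ℚ.≤ (+ a ℚ./ b) ℚ.* (+ 1 ℚ./ K₃) ℚ.+ (+ c ℚ./ d) ℚ.* (+ 1 ℚ./ K₂)
  fraction-≤-sum h = subst (+ P ℚ./ D ℚ.≤_) (sym common) (/-≤ P D num den {{d≢0 = product≢0}} h)

  -- At k = 3 + t: K₃ = k³, K₂ = k², and P / D is the coefficient.
  module _ (t : ℕ) (K₃≡ : K₃ ≡ ⟦ cubeᴾ ⟧ t) (K₂≡ : K₂ ≡ ⟦ squareᴾ ⟧ t)
           (P≡ : P ≡ ⟦ numeratorᴾ ⟧ t) (D≡ : D ≡ ⟦ denominatorᴾ ⟧ t) where

    private
      bcube≡ : b * K₃ ≡ ⟦ (b ∷ []) ⊗ cubeᴾ ⟧ t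
      bcube≡ = ⊗-≡ (b ∷ []) cubeᴾ t (const⟦⟧ b t) K₃≡

      dsquare≡ : d * K₂ ≡ ⟦ (d ∷ []) ⊗ squareᴾ ⟧ t
      dsquare≡ = ⊗-≡ (d ∷ []) squareᴾ t (const⟦⟧ d t) K₂≡

      sum≡ : num * D ≡ ⟦ sumᴾ a b c d ⟧ t
      sum≡ = ⊗-≡ ((a * 1 ∷ []) ⊗ ((d ∷ []) ⊗ squareᴾ) ⊕ (c * 1 ∷ []) ⊗ ((b ∷ []) ⊗ cubeᴾ)) denominatorᴾ t
        (⊕-≡ ((a * 1 ∷ []) ⊗ ((d ∷ []) ⊗ squareᴾ)) ((c * 1 ∷ []) ⊗ ((b ∷ []) ⊗ cubeᴾ)) t
          (⊗-≡ (a * 1 ∷ []) ((d ∷ []) ⊗ squareᴾ) t (const⟦⟧ (a * 1) t) dsquare≡)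
          (⊗-≡ (c * 1 ∷ []) ((b ∷ []) ⊗ cubeᴾ) t (const⟦⟧ (c * 1) t) bcube≡))
        D≡

      product≡ : P * den ≡ ⟦ productᴾ b d ⟧ t
      product≡ = ⊗-≡ numeratorᴾ (((b ∷ []) ⊗ cubeᴾ) ⊗ ((d ∷ []) ⊗ squareᴾ)) t P≡
        (⊗-≡ ((b ∷ []) ⊗ cubeᴾ) ((d ∷ []) ⊗ squareᴾ) t bcube≡ dsquare≡)

    -- Moving the k⁻² term to the other side and clearing denominators leaves two polynomials of
    -- degree 7 in `t`. For c/d = 8000/12321 their leading coefficients agree, so the next ones
    -- compare a/b with the k⁻³ coefficient of the expansion.
    expansion-≥ : Pointwise _≤_ (sumᴾ a b c d) (productᴾ b d) →
      (+ a ℚ./ b) ℚ.* (+ 1 ℚ./ K₃) ℚ.≤ (+ P ℚ./ D) ℚ.- (+ c ℚ./ d) ℚ.* (+ 1 ℚ./ K₂)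
    expansion-≥ sum≤product =
      ≤-minus (sum-≤-fraction (subst₂ _≤_ (sym sum≡) (sym product≡) (⟦⟧-mono t sum≤product)))

    expansion-≤ : Pointwise _≤_ (productᴾ b d) (sumᴾ a b c d) →
      (+ P ℚ./ D) ℚ.- (+ c ℚ./ d) ℚ.* (+ 1 ℚ./ K₂) ℚ.≤ (+ a ℚ./ b) ℚ.* (+ 1 ℚ./ K₃)
    expansion-≤ product≤sum =
      minus-≤ (fraction-≤-sum (subst₂ _≤_ (sym product≡) (sym sum≡) (⟦⟧-mono t product≤sum)))

module _ (t : ℕ) where

  private
    pages≡ : 3 + t ≡ ⟦ pagesᴾ ⟧ t
    pages≡ = trans (cong (λ x → 3 + x) (sym (*-identityˡ t))) (lin 3 1 t)

    square≡ : (3 + t) ^ 2 ≡ ⟦ squareᴾ ⟧ t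
    square≡ = ⊗-≡ pagesᴾ (pagesᴾ ⊗ (1 ∷ [])) t pages≡ (⊗-≡ pagesᴾ (1 ∷ []) t pages≡ (const⟦⟧ 1 t))

    cube≡ : (3 + t) ^ 3 ≡ ⟦ cubeᴾ ⟧ t
    cube≡ = ⊗-≡ pagesᴾ squareᴾ t pages≡ square≡

    error : ℚ → ℚ
    error q = q ℚ.- (+ 8000 ℚ./ 12321) ℚ.* (1/ (3 + t) ^ 2)

  error-≥ : (+ 1 ℚ./ 5) ℚ.* (1/ (3 + t) ^ 3) ℚ.≤ coefficient (3 + t) ℚ.- (+ 8000 ℚ./ 12321) ℚ.* (1/ (3 + t) ^ 2)
  error-≥ = subst (λ q → (+ 1 ℚ./ 5) ℚ.* (1/ (3 + t) ^ 3) ℚ.≤ error q) (sym (coefficient≡ t))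
    (expansion-≥ 1 5 8000 12321 ((3 + t) ^ 3) ((3 + t) ^ 2) (numerator t) (denominator (3 + t))
      {{_}} {{_}} {{m^n≢0 (3 + t) 3}} {{m^n≢0 (3 + t) 2}} {{denominator≢0 (3 + t)}}
      t cube≡ square≡ refl (denominator≡ t) (from-yes (decidable _≤?_ (sumᴾ 1 5 8000 12321) (productᴾ 5 12321))))

  error-≤ : coefficient (3 + t) ℚ.- (+ 8000 ℚ./ 12321) ℚ.* (1/ (3 + t) ^ 2) ℚ.≤ (+ 1 ℚ./ 4) ℚ.* (1/ (3 + t) ^ 3)
  error-≤ = subst (λ q → error q ℚ.≤ (+ 1 ℚ./ 4) ℚ.* (1/ (3 + t) ^ 3)) (sym (coefficient≡ t))
    (expansion-≤ 1 4 8000 12321 ((3 + t) ^ 3) ((3 + t) ^ 2) (numerator t) (denominator (3 + t))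
      {{_}} {{_}} {{m^n≢0 (3 + t) 3}} {{m^n≢0 (3 + t) 2}} {{denominator≢0 (3 + t)}}
      t cube≡ square≡ refl (denominator≡ t) (from-yes (decidable _≤?_ (productᴾ 4 12321) (sumᴾ 1 4 8000 12321))))

theorem2 : (∀ (k n : ℕ) .{{_ : NonZero k}} → 3 ≤ k → (111 * k) / 20 ≤ n →
    coefficient k ℚ.* fromℕ (n C 4) ℚ.≤ fromℕ (ν k n))
    × (λ k → coefficient k ℚ.- (+ 8000 ℚ./ 12321) ℚ.* (1/ k ^ 2)) ∈Θ (λ k → 1/ k ^ 3)
theorem2 =
  (λ { (suc (suc (suc t))) n (s≤s (s≤s (s≤s z≤n))) bound → lower-bound t n (≤-trans (5k≤111k/20 t) bound) }) ,
  -- The k⁻³ coefficient is 8000/12321 · (188/111 - 5416/4107) ≈ 0.243, which lies between 1/5 and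
  -- 1/4.
  + 1 ℚ./ 5 , + 1 ℚ./ 4 , 3 , from-yes (0ℚ ℚ.<? + 1 ℚ./ 5) , from-yes (0ℚ ℚ.<? + 1 ℚ./ 4) ,
  λ { (suc (suc (suc t))) (s≤s (s≤s (s≤s z≤n))) → error-≥ t , error-≤ t }
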